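{- There exist absolute constants $c, C>0$ such that for all integers $n$ and $k\geq 2$, the minimum number $T(n,k)$ of adaptive queries needed to solve black-peg Mastermind with $n$ positions and $k$ colors satisfies $$c\left(n\frac{\log k}{\log n}+k\right)\leq T(n,k)\leq C\left(n\frac{\log k}{\log n}+k\right),$$ i.e. $T(n,k)=\Theta\left(n\frac{\log k}{\log n}+k\right)$.
   Context: Black-peg Mastermind with $n$ positions and $k$ colors: Codemaker chooses a hidden codeword $x\in[k]^n$. Codebreaker adaptively asks queries $q\in[k]^n$ (each query may depend on all previous answers) and after each query is told the number of black pegs $bp(x,q)=|\{i\in[n]: x_i=q_i\}|$. The game is solved once the answers received determine $x$ uniquely, i.e. every $x'\neq x$ in $[k]^n$ would have given a different answer to at least one of the queries asked. The minimum number of adaptive queries needed is the least $T$ such that Codebreaker has an adaptive strategy that determines every possible codeword within $T$ queries. -}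

module Defs where

open import Data.Nat using (ℕ; zero; suc; _+_; _*_; _≤_)
open import Data.Fin using (Fin)
open import Data.Fin.Properties using (_≟_)
open import Data.Vec using (Vec; []; _∷_)
open import Data.Product using (_×_; _,_; Σ)
open import Data.Unit using (⊤; tt)
open import Relation.Nullary using (yes; no)
open import Relation.Binary.PropositionalEquality using (_≡_)

Code : ℕ → ℕ → Set
Code n k = Vec (Fin k) n

bp : ∀ {n k} → Code n k → Code n k → ℕ
bp [] [] = 0
bp (a ∷ x) (b ∷ q) with a ≟ b
... | yes _ = suc (bp x q)
... | no  _ = bp x q

Strategy : ℕ → ℕ → ℕ → Set
Strategy n k zero    = ⊤
Strategy n k (suc t) = Code n k × (ℕ → Strategy n k t)

-- responses S x y : the answers codeword y would give to the queries that
-- S asks when the hidden codeword is x (the path followed is x's path).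
responses : ∀ {n k t} → Strategy n k t → Code n k → Code n k → Vec ℕ t
responses {t = zero}  tt      x y = []
responses {t = suc t} (q , f) x y = bp y q ∷ responses (f (bp x q)) x y

Solves : ∀ {n k t} → Strategy n k t → Set
Solves {n} {k} S = ∀ (x y : Code n k) → responses S x y ≡ responses S x x → y ≡ x

SolvableIn : ℕ → ℕ → ℕ → Set
SolvableIn n k t = Σ (Strategy n k t) Solves

{-# OPTIONS --safe #-}
module Submission where

-- Lower bound. Different codes have different answer sequences, so k ^ n ≤ (n + 1) ^ t; and if
-- all answers are zero, a position for which two colours were never asked stays undetermined.
--
-- Upper bound. Arrange the positions as a binary tree and locate each colour by halving: if colour c
-- occurs v times below a node, ask how often it occurs below the left child. An answer carries only
-- about log v bits, so many such questions must share queries. Suppose p = 4 ^ r disjoint blocks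
-- are being solved in parallel. Instead of the p queries A they want to ask, ask the rows of the
-- Sylvester-Hadamard transform of A; row w (a sign vector) may be perturbed by any integer smaller
-- than 2 ^ (number of true entries of w) and A is still recovered together with the
-- perturbation. So more than half of the rows can each carry, for free, an additional question about
-- another part of the tree whose answers vary by less than 2 ^ r.
--
-- In a block of positions, colours with 2 ^ ρ to 2 ^ (ρ + 1) occurrences below a node are handled in
-- phase ρ, for decreasing ρ. There are few of them, so phase ρ costs O((ρ + 1) s / 2 ^ ρ) for a
-- block of size s, and all phases together O(s). Inside a phase, one half of the sub-blocks is solved while
-- the free questions prepare the other half. Finally blocks of size about k are combined by the
-- same device, which saves a factor of about log n / log k as long as k is small compared with n.

open import Defs
open import Data.Nat as ℕ using (ℕ; zero; suc; _+_; _*_; _^_; _∸_; _≤_; _<_; z≤n; s≤s; _≤?_)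
import Data.Nat.DivMod as DivMod
open import Data.Nat.Induction using (<-rec)
open import Data.Nat.ListAction using (sum)
open import Data.Nat.Logarithm using (⌊log₂_⌋; ⌊log₂⌋-mono-≤; ⌊log₂⌊n/2⌋⌋≡⌊log₂n⌋∸1)
import Data.Nat.Properties as ℕₚ
open import Data.Nat.Tactic.RingSolver using () renaming (solve-∀ to solveℕ-∀)
open import Data.Integer as ℤ using (ℤ; 0ℤ; +_; -_; ∣_∣)
import Data.Integer.Properties as ℤₚ
open import Data.Integer.Tactic.RingSolver using (solve-∀)
open import Data.Bool using (Bool; true; false; not; if_then_else_)
open import Data.Empty using (⊥-elim)
open import Data.Fin as Fin using (Fin; zero; suc)
import Data.Fin.Properties as Finₚ
open import Data.List as List using (List; []; _∷_; length; filter; allFin; tabulate; cartesianProductWith)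
import Data.List.Properties as Listₚ
open import Data.List.Membership.Propositional using (_∈_)
open import Data.List.Membership.Propositional.Properties using (∈-filter⁺; ∈-filter⁻; ∈-allFin; ∈-cartesianProductWith⁺)
open import Data.List.Relation.Unary.Any using (here; there)
open import Data.Maybe using (Maybe; just; nothing; maybe′; _>>=_)
open import Data.Product using (_×_; _,_; Σ; proj₁; proj₂)
open import Data.Product.Function.NonDependent.Propositional using (_×-↔_)
open import Data.Sum using (_⊎_; inj₁; inj₂; [_,_]′)
open import Data.Unit using (⊤; tt)
open import Data.Vec as Vec using (Vec; []; _∷_; _++_)
import Data.Vec.Properties as Vecₚ
open import Function using (_∘_; _↔_; Inverse; mk↔ₛ′)
open import Function.Properties.Inverse using (↔-refl; ↔-sym; ↔-trans)
open import Relation.Binary.PropositionalEquality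
  using (_≡_; _≢_; refl; sym; trans; cong; cong₂; subst; subst₂; _≗_; module ≡-Reasoning)
open import Relation.Nullary using (yes; no; does; ¬_; ¬?)
open import Relation.Nullary.Decidable using (_×-dec_; decidable-stable)

-- Integers and the Sylvester-Hadamard transform

i+j≡0⇒i≡-j : ∀ i j → i ℤ.+ j ≡ 0ℤ → i ≡ - j
i+j≡0⇒i≡-j i j eq = trans (trans (lemma i j) (cong (ℤ._+ - j) eq)) (ℤₚ.+-identityˡ (- j))
  where
  lemma : ∀ i j → i ≡ (i ℤ.+ j) ℤ.+ - j
  lemma = solve-∀

+-cancelˡ : ∀ i {j k} → i ℤ.+ j ≡ i ℤ.+ k → j ≡ k
+-cancelˡ i {j} {k} eq =
  ℤₚ.i-j≡0⇒i≡j j k (trans (lemma i j k) (ℤₚ.i≡j⇒i-j≡0 eq))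
  where
  lemma : ∀ i j k → j ℤ.- k ≡ (i ℤ.+ j) ℤ.- (i ℤ.+ k)
  lemma = solve-∀

j-i≡-[i-j] : ∀ i j → j ℤ.- i ≡ - (i ℤ.- j)
j-i≡-[i-j] = solve-∀

W : ℕ → Set
W = Vec Bool

weight : ∀ {d} → W d → ℕ
weight []          = 0
weight (true  ∷ w) = suc (weight w)
weight (false ∷ w) = weight w

flip : ∀ {d} → W d → W d
flip = Vec.map not

flip-flip : ∀ {d} (w : W d) → flip (flip w) ≡ w
flip-flip []          = refl
flip-flip (true  ∷ w) = cong (true ∷_) (flip-flip w)
flip-flip (false ∷ w) = cong (false ∷_) (flip-flip w)

weight-flip : ∀ {d} (w : W d) → weight w + weight (flip w) ≡ d
weight-flip []          = refl
weight-flip (true  ∷ w) = cong suc (weight-flip w)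
weight-flip (false ∷ w) = trans (ℕₚ.+-suc (weight w) _) (cong suc (weight-flip w))

heavy-or-flip : ∀ r (w : W (r + r)) → r ≤ weight w ⊎ r ≤ weight (flip w)
heavy-or-flip r w with r ≤? weight w | r ≤? weight (flip w)
... | yes p | _     = inj₁ p
... | no _  | yes q = inj₂ q
... | no ¬p | no ¬q = ⊥-elim (ℕₚ.<-irrefl (weight-flip w) (ℕₚ.+-mono-< (ℕₚ.≰⇒> ¬p) (ℕₚ.≰⇒> ¬q)))

-- The Sylvester-Hadamard transform; `w` names a row by its sign at each level of the recursion.
had : ∀ {d} → (W d → ℤ) → W d → ℤ
had u []          = u []
had u (true  ∷ w) = had (u ∘ (true ∷_)) w ℤ.+ had (u ∘ (false ∷_)) w
had u (false ∷ w) = had (u ∘ (true ∷_)) w ℤ.- had (u ∘ (false ∷_)) w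

had-cong : ∀ {d} {u v : W d → ℤ} → u ≗ v → had u ≗ had v
had-cong e []          = e []
had-cong e (true  ∷ w) = cong₂ ℤ._+_ (had-cong (e ∘ (true ∷_)) w) (had-cong (e ∘ (false ∷_)) w)
had-cong e (false ∷ w) = cong₂ ℤ._-_ (had-cong (e ∘ (true ∷_)) w) (had-cong (e ∘ (false ∷_)) w)

had-sub : ∀ {d} (u v : W d → ℤ) w → had (λ a → u a ℤ.- v a) w ≡ had u w ℤ.- had v w
had-sub u v []          = refl
had-sub u v (true  ∷ w)
  rewrite had-sub (u ∘ (true ∷_)) (v ∘ (true ∷_)) w | had-sub (u ∘ (false ∷_)) (v ∘ (false ∷_)) w
  = lemma (had (u ∘ (true ∷_)) w) (had (v ∘ (true ∷_)) w) (had (u ∘ (false ∷_)) w) (had (v ∘ (false ∷_)) w)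
  where
  lemma : ∀ a b c d → (a ℤ.- b) ℤ.+ (c ℤ.- d) ≡ (a ℤ.+ c) ℤ.- (b ℤ.+ d)
  lemma = solve-∀
had-sub u v (false ∷ w)
  rewrite had-sub (u ∘ (true ∷_)) (v ∘ (true ∷_)) w | had-sub (u ∘ (false ∷_)) (v ∘ (false ∷_)) w
  = lemma (had (u ∘ (true ∷_)) w) (had (v ∘ (true ∷_)) w) (had (u ∘ (false ∷_)) w) (had (v ∘ (false ∷_)) w)
  where
  lemma : ∀ a b c d → (a ℤ.- b) ℤ.- (c ℤ.- d) ≡ (a ℤ.- c) ℤ.- (b ℤ.- d)
  lemma = solve-∀

-- The rows that start with false vanish first, so both halves of u agree, and the other rows are
-- then twice the rows of one half: the doubled tolerance is exactly what one more true provides.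
had-zero : ∀ {d} (u : W d → ℤ) → (∀ w → ∣ had u w ∣ < 2 ^ weight w) → ∀ a → u a ≡ 0ℤ
had-zero {zero}  u small [] = ℤₚ.∣i∣≡0⇒i≡0 (ℕₚ.n<1⇒n≡0 (small []))
had-zero {suc d} u small = all
  where
  uₜ u_f : W d → ℤ
  uₜ  = u ∘ (true ∷_)
  u_f = u ∘ (false ∷_)
  same : ∀ a → uₜ a ≡ u_f a
  same a = ℤₚ.i-j≡0⇒i≡j (uₜ a) (u_f a)
    (had-zero (λ a → uₜ a ℤ.- u_f a)
      (λ w → subst (λ z → ∣ z ∣ < 2 ^ weight w) (sym (had-sub uₜ u_f w)) (small (false ∷ w))) a)
  double : ∀ i → i ℤ.+ i ≡ + 2 ℤ.* i
  double = solve-∀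
  twice : ∀ w → ∣ had u (true ∷ w) ∣ ≡ 2 * ∣ had uₜ w ∣
  twice w = begin
    ∣ had uₜ w ℤ.+ had u_f w ∣ ≡⟨ cong (λ z → ∣ had uₜ w ℤ.+ z ∣) (had-cong same w) ⟨
    ∣ had uₜ w ℤ.+ had uₜ w ∣  ≡⟨ cong ∣_∣ (double (had uₜ w)) ⟩
    ∣ + 2 ℤ.* had uₜ w ∣       ≡⟨ ℤₚ.abs-* (+ 2) (had uₜ w) ⟩
    2 * ∣ had uₜ w ∣           ∎
    where open ≡-Reasoning
  zeroₜ : ∀ a → uₜ a ≡ 0ℤ
  zeroₜ = had-zero uₜ (λ w → ℕₚ.*-cancelˡ-< 2 _ _
    (subst (_< 2 * 2 ^ weight w) (twice w) (small (true ∷ w))))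
  all : ∀ a → u a ≡ 0ℤ
  all (true  ∷ a) = zeroₜ a
  all (false ∷ a) = trans (sym (same a)) (zeroₜ a)

-- The partial inverse tells each slot `j` which item it carries; slots without an item stay blank.
record _↣ₚ_ (I J : Set) : Set where
  field
    into  : I → J
    from  : J → Maybe I
    from-into : ∀ i → from (into i) ≡ just i
open _↣ₚ_ public

data Shape : Set where
  leaf : Shape
  _⊗_  : Shape → Shape → Shape

Pow : ℕ → Shape → Shape
Pow zero    A = A
Pow (suc d) A = Pow d A ⊗ Pow d A

-- Limits on how far the answers of codes not yet told apart may differ: plans that form the
-- transformed copies need none, plans whose queries ride along as items need `Small r`.
Any : ℤ → Set
Any _ = ⊤

Small : ℕ → ℤ → Set
Small r z = ∣ z ∣ < 2 ^ r

small0 : ∀ r → Small r 0ℤ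
small0 r = ℕₚ.m^n>0 2 r

-- Signed queries and adaptive plans

module Colours (κ : ℕ) where

  -- Two colours are built in: `zero` is the filling, and `suc zero` serves to detect it in `zeros`.
  Colour : Set
  Colour = Fin (suc (suc κ))

  data X : Shape → Set where
    lf  : Colour → X leaf
    _∙_ : ∀ {A B} → X A → X B → X (A ⊗ B)

  -- A real query cannot leave a position blank, but a difference of two real queries can; colour
  -- zero serves as the filling, so a signed query measures a colour against colour zero.
  data Q : Shape → Set where
    blank      : Q leaf
    plus minus : Colour → Q leaf
    _∙_        : ∀ {A B} → Q A → Q B → Q (A ⊗ B)

  ind : Colour → Colour → ℕ
  ind c a = if does (a Finₚ.≟ c) then 1 else 0

  ans : ∀ {A} → X A → Q A → ℤ
  ans (lf a)  blank     = 0ℤ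
  ans (lf a)  (plus c)  = + ind c a ℤ.- + ind zero a
  ans (lf a)  (minus c) = + ind zero a ℤ.- + ind c a
  ans (l ∙ r) (p ∙ q)   = ans l p ℤ.+ ans r q

  none : ∀ A → Q A
  none leaf    = blank
  none (A ⊗ B) = none A ∙ none B

  neg : ∀ {A} → Q A → Q A
  neg blank     = blank
  neg (plus c)  = minus c
  neg (minus c) = plus c
  neg (p ∙ q)   = neg p ∙ neg q

  ans-none : ∀ {A} (x : X A) → ans x (none A) ≡ 0ℤ
  ans-none (lf a)  = refl
  ans-none (l ∙ r) = cong₂ ℤ._+_ (ans-none l) (ans-none r)

  ans-neg : ∀ {A} (x : X A) q → ans x (neg q) ≡ - ans x q
  ans-neg (lf a)  blank     = refl
  ans-neg (lf a)  (plus c)  = j-i≡-[i-j] (+ ind c a) (+ ind zero a)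
  ans-neg (lf a)  (minus c) = j-i≡-[i-j] (+ ind zero a) (+ ind c a)
  ans-neg (l ∙ r) (p ∙ q)   =
    trans (cong₂ ℤ._+_ (ans-neg l p) (ans-neg r q)) (sym (ℤₚ.neg-distrib-+ (ans l p) (ans r q)))

  -- K x y is read as: x and y have not been told apart so far.
  Rel : Shape → Set₁
  Rel A = X A → X A → Set

  -- An adaptive plan leading from K to K′ in t rounds, each of which asks one query for every i : I
  -- simultaneously. A query is a function of the hidden x, admissible if codes that have not been
  -- told apart yield equivalent queries; Ok limits how much the answers of such codes may differ.
  data Proc (A : Shape) (Ok : ℤ → Set) (I : Set) (K′ : Rel A) : ℕ → Rel A → Set₁ where
    stop : ∀ {K} → (∀ x y → K x y → K′ x y) → Proc A Ok I K′ 0 K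
    step : ∀ {t K} (K″ : Rel A) (f : X A → I → Q A)
      → (∀ x y → K x y → ∀ i z → ans z (f x i) ≡ ans z (f y i))
      → (∀ x y → K x y → ∀ i → Ok (ans x (f x i) ℤ.- ans y (f x i)))
      → (∀ x y → K x y → (∀ i → ans x (f x i) ≡ ans y (f x i)) → K″ x y)
      → Proc A Ok I K′ t K″ → Proc A Ok I K′ (suc t) K

  _⊠_ : ∀ {A B} → Rel A → Rel B → Rel (A ⊗ B)
  (K ⊠ L) (x ∙ u) (y ∙ v) = K x y × L u v

  pre : ∀ {A Ok I K′ t K L} → (∀ x y → L x y → K x y) → Proc A Ok I K′ t K → Proc A Ok I K′ t L
  pre h (stop g)              = stop (λ x y l → g x y (h x y l))
  pre h (step K″ f r o k P) =
    step K″ f (λ x y l → r x y (h x y l)) (λ x y l → o x y (h x y l)) (λ x y l → k x y (h x y l)) P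

  post : ∀ {A Ok I K′ K″ t K} → (∀ x y → K′ x y → K″ x y) → Proc A Ok I K′ t K → Proc A Ok I K″ t K
  post h (stop g)           = stop (λ x y l → h x y (g x y l))
  post h (step L f r o k P) = step L f r o k (post h P)

  infixr 4 _⨾_
  _⨾_ : ∀ {A Ok I K′ K″ t t′ K} → Proc A Ok I K′ t K → Proc A Ok I K″ t′ K′ → Proc A Ok I K″ (t + t′) K
  stop g           ⨾ R = pre g R
  step L f r o k P ⨾ R = step L f r o k (P ⨾ R)

  -- Whether `L` holds depends on the two codes alone, so it survives every plan.
  frame : ∀ {A Ok I K′ t K} (L : Rel A) → Proc A Ok I K′ t K →
          Proc A Ok I (λ x y → K′ x y × L x y) t (λ x y → K x y × L x y)
  frame L (stop g)           = stop (λ x y (k , l) → g x y k , l)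
  frame L (step M f r o k P) = step (λ x y → M x y × L x y) f
    (λ x y (m , _) → r x y m) (λ x y (m , _) → o x y m) (λ x y (m , l) e → k x y m e , l) (frame L P)

  idle : ∀ {A Ok I} {K K′ : Rel A} → Ok 0ℤ → (∀ x y → K x y → K′ x y) → ∀ t → Proc A Ok I K′ t K
  idle ok h zero = stop h
  idle {A} {Ok} {K = K} ok h (suc t) = step K (λ _ _ → none A) (λ _ _ _ _ _ → refl)
    (λ x y _ _ → subst Ok (sym (cong₂ ℤ._-_ (ans-none x) (ans-none y))) ok) (λ _ _ m _ → m) (idle ok h t)

  pad : ∀ {A Ok I K′ t t′ K} → Ok 0ℤ → t ≤ t′ → Proc A Ok I K′ t K → Proc A Ok I K′ t′ K
  pad ok z≤n     (stop g)           = idle ok g _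
  pad ok (s≤s p) (step M f r o k P) = step M f r o k (pad ok p P)

  okMap : ∀ {A Ok Ok′ I K′ t K} → (∀ x y q → Ok′ (ans {A} x q ℤ.- ans y q)) →
          Proc A Ok I K′ t K → Proc A Ok′ I K′ t K
  okMap h (stop g)           = stop g
  okMap h (step M f r o k P) = step M f r (λ x y _ i → h x y (f x i)) k (okMap h P)

  reindex : ∀ {A Ok I J K′ t K} → Ok 0ℤ → I ↣ₚ J → Proc A Ok I K′ t K → Proc A Ok J K′ t K
  reindex ok ι (stop g) = stop g
  reindex {A} {Ok} {I} {J} {K = K} ok ι (step M f r o k P) = step M f′ r′ o′ k′ (reindex ok ι P)
    where
    f′ : X A → J → Q A
    f′ x j = maybe′ (f x) (none A) (from ι j)
    r′ : ∀ x y → K x y → ∀ j z → ans z (f′ x j) ≡ ans z (f′ y j)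
    r′ x y m j z with from ι j
    ... | just i  = r x y m i z
    ... | nothing = refl
    o′ : ∀ x y → K x y → ∀ j → Ok (ans x (f′ x j) ℤ.- ans y (f′ x j))
    o′ x y m j with from ι j
    ... | just i  = o x y m i
    ... | nothing = subst Ok (sym (cong₂ ℤ._-_ (ans-none x) (ans-none y))) ok
    k′ : ∀ x y → K x y → (∀ j → ans x (f′ x j) ≡ ans y (f′ x j)) → M x y
    k′ x y m e = k x y m λ i →
      subst (λ s → ans x (maybe′ (f x) (none A) s) ≡ ans y (maybe′ (f x) (none A) s))
            (from-into ι i) (e (into ι i))

  -- `lift` is adjoint to `proj` with respect to `ans`; this suffices to transport whole plans.
  record Hom (A B : Shape) : Set where
    field
      proj : X B → X A
      lift : Q A → Q B
      ans-lift : ∀ y q → ans y (lift q) ≡ ans (proj y) q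
  open Hom public

  pull : ∀ {A B Ok I K′ t K} (h : Hom A B) → Proc A Ok I K′ t K →
         Proc B Ok I (λ x y → K′ (proj h x) (proj h y)) t (λ x y → K (proj h x) (proj h y))
  pull h (stop g) = stop (λ x y → g (proj h x) (proj h y))
  pull {Ok = Ok} h (step M f r o k P) = step (λ x y → M (proj h x) (proj h y))
    (λ x i → lift h (f (proj h x) i))
    (λ x y m i z → trans (ans-lift h z _) (trans (r _ _ m i (proj h z)) (sym (ans-lift h z _))))
    (λ x y m i → subst Ok (sym (cong₂ ℤ._-_ (ans-lift h x _) (ans-lift h y _))) (o _ _ m i))
    (λ x y m e → k _ _ m λ i → trans (sym (ans-lift h x _)) (trans (e i) (ans-lift h y _)))
    (pull h P)

  leftHom : ∀ {A B} → Hom A (A ⊗ B)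
  leftHom {A} {B} = record
    { proj = λ { (x ∙ _) → x } ; lift = _∙ none B
    ; ans-lift = λ { (x ∙ u) q → trans (cong (λ s → ans x q ℤ.+ s) (ans-none u)) (ℤₚ.+-identityʳ _) } }

  swapHom : ∀ {A B} → Hom (B ⊗ A) (A ⊗ B)
  swapHom = record
    { proj = λ { (x ∙ u) → u ∙ x } ; lift = λ { (p ∙ q) → q ∙ p }
    ; ans-lift = λ { (x ∙ u) (p ∙ q) → ℤₚ.+-comm (ans x q) (ans u p) } }

  left : ∀ {A B Ok I K′ t K} (L : Rel B) → Proc A Ok I K′ t K → Proc (A ⊗ B) Ok I (K′ ⊠ L) t (K ⊠ L)
  left L P = post (λ { (x ∙ u) (y ∙ v) m → m }) (pre (λ { (x ∙ u) (y ∙ v) m → m })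
    (frame (λ { (_ ∙ u) (_ ∙ v) → L u v }) (pull leftHom P)))

  swapped : ∀ {A B Ok I K′ L′ t K L} → Proc (A ⊗ B) Ok I (K′ ⊠ L′) t (K ⊠ L) →
            Proc (B ⊗ A) Ok I (L′ ⊠ K′) t (L ⊠ K)
  swapped P = post (λ { (x ∙ u) (y ∙ v) (m , n) → n , m })
    (pre (λ { (x ∙ u) (y ∙ v) (m , n) → n , m }) (pull swapHom P))

  -- All `τ` rounds are admissible from `K` alone, so they can be fixed in advance without using
  -- each other's answers.
  chunked : ∀ {A Ok} {I : Set} {K : Rel A} τ (f : X A → Fin τ → I → Q A)
    → (∀ x y → K x y → ∀ s i z → ans z (f x s i) ≡ ans z (f y s i))
    → (∀ x y → K x y → ∀ s i → Ok (ans x (f x s i) ℤ.- ans y (f x s i)))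
    → Proc A Ok I (λ x y → K x y × (∀ s i → ans x (f x s i) ≡ ans y (f x s i))) τ K
  chunked zero    f r o = stop (λ x y k → k , λ ())
  chunked {K = K} (suc τ) f r o = step (λ x y → K x y × (∀ i → ans x (f x zero i) ≡ ans y (f x zero i)))
    (λ x → f x zero) (λ x y k → r x y k zero) (λ x y k → o x y k zero) (λ x y k e → k , e)
    (post (λ { x y ((k , e) , e′) → k , λ { zero → e ; (suc s) → e′ s } })
      (chunked τ (λ x s → f x (suc s)) (λ x y (k , _) s → r x y k (suc s)) (λ x y (k , _) s → o x y k (suc s))))

  -- The queries of one round do not depend on each other's answers, so they can be asked one at a
  -- time.
  flatten : ∀ {A Ok I K′ t K} b → I ↔ Fin b → Proc A Ok I K′ t K → Proc A Ok ⊤ K′ (t * b) K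
  flatten b ι (stop g)           = stop g
  flatten b ι (step M f r o k P) =
    post (λ x y (m , e) → k x y m λ i → subst (λ i → ans x (f x i) ≡ ans y (f x i)) (inverseʳ ι refl) (e (Inverse.to ι i) tt))
      (chunked b (λ x s _ → f x (Inverse.from ι s)) (λ x y m s _ → r x y m _) (λ x y m s _ → o x y m _))
    ⨾ flatten b ι P
    where open Inverse using (inverseʳ)

  get : ∀ {A} d → W d → X (Pow d A) → X A
  get zero    []          x       = x
  get (suc d) (true  ∷ a) (l ∙ r) = get d a l
  get (suc d) (false ∷ a) (l ∙ r) = get d a r

  put : ∀ {A} d → W d → Q A → Q (Pow d A)
  put zero    []          q = q
  put (suc d) (true  ∷ a) q = put d a q ∙ none _
  put (suc d) (false ∷ a) q = none _ ∙ put d a q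

  ans-put : ∀ {A} d a (x : X (Pow d A)) q → ans x (put d a q) ≡ ans (get d a x) q
  ans-put zero    []          x       q = refl
  ans-put (suc d) (true  ∷ a) (l ∙ r) q = trans (cong₂ ℤ._+_ (ans-put d a l q) (ans-none r)) (ℤₚ.+-identityʳ _)
  ans-put (suc d) (false ∷ a) (l ∙ r) q = trans (cong₂ ℤ._+_ (ans-none l) (ans-put d a r q)) (ℤₚ.+-identityˡ _)

  PowRel : ∀ {A} d → Rel A → Rel (Pow d A)
  PowRel d K x y = ∀ a → K (get d a x) (get d a y)

  parallel : ∀ {A Ok J K′ t K} d → Proc A Ok J K′ t K →
             Proc (Pow d A) Ok (W d × J) (PowRel d K′) t (PowRel d K)
  parallel d (stop g) = stop (λ x y m a → g _ _ (m a))
  parallel {Ok = Ok} d (step M f r o k P) = step (PowRel d M)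
    (λ x (a , j) → put d a (f (get d a x) j))
    (λ x y m (a , j) z → trans (ans-put d a z _) (trans (r _ _ (m a) j (get d a z)) (sym (ans-put d a z _))))
    (λ x y m (a , j) → subst Ok (sym (cong₂ ℤ._-_ (ans-put d a x _) (ans-put d a y _))) (o _ _ (m a) j))
    (λ x y m e a → k _ _ (m a) λ j → trans (sym (ans-put d a x _)) (trans (e (a , j)) (ans-put d a y _)))
    (parallel d P)

  -- Negating a query supplies the sign -1, so a row of the transform is again a single signed
  -- query.
  cell : ∀ {A} d → W d → (W d → Q A) → Q (Pow d A)
  cell zero    []          h = h []
  cell (suc d) (true  ∷ w) h = cell d w (h ∘ (true ∷_)) ∙ cell d w (h ∘ (false ∷_))
  cell (suc d) (false ∷ w) h = cell d w (h ∘ (true ∷_)) ∙ neg (cell d w (h ∘ (false ∷_)))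

  ans-cell : ∀ {A} d w h (x : X (Pow d A)) → ans x (cell d w h) ≡ had (λ a → ans (get d a x) (h a)) w
  ans-cell zero    []          h x       = refl
  ans-cell (suc d) (true  ∷ w) h (l ∙ r) = cong₂ ℤ._+_ (ans-cell d w _ l) (ans-cell d w _ r)
  ans-cell (suc d) (false ∷ w) h (l ∙ r) =
    cong₂ ℤ._+_ (ans-cell d w _ l) (trans (ans-neg r (cell d w _)) (cong -_ (ans-cell d w _ r)))

  -- Each row of the transformed copies has room for one item. The item (a , j) is put into row a or
  -- into row flip a, one of which has weight at least r; this is what the two values of Bool are for.
  merge : ∀ {A B J K′ t K L′ L} r → Proc A Any (Bool × J) K′ t K →
          Proc B (Small r) (W (r + r) × J) L′ t L →
          Proc (Pow (r + r) A ⊗ B) Any (Bool × (W (r + r) × J))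
            (PowRel (r + r) K′ ⊠ L′) t (PowRel (r + r) K ⊠ L)
  merge r (stop g) (stop h) = stop (λ { (x ∙ u) (y ∙ v) (m , n) → (λ a → g _ _ (m a)) , h u v n })
  merge {A} {B} {J} {t = suc t} {K} {L = L} r (step M f rf of kf P) (step N g rg og kg R) =
    step (PowRel d M ⊠ N) row resp (λ _ _ _ _ → tt) learn (merge r P R)
    where
    d = r + r
    origin : Bool → W d → W d
    origin true  w = w
    origin false w = flip w
    item : X B → Bool → W d → J → Q B
    item u s w j with r ≤? weight w
    ... | yes _ = g u (origin s w , j)
    ... | no  _ = none B
    row : X (Pow d A ⊗ B) → Bool × (W d × J) → Q (Pow d A ⊗ B)
    row (x ∙ u) (s , w , j) = cell d w (λ a → f (get d a x) (s , j)) ∙ item u s w j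
    resp : ∀ x y → (PowRel d K ⊠ L) x y → ∀ i z → ans z (row x i) ≡ ans z (row y i)
    resp (x ∙ u) (y ∙ v) (m , n) (s , w , j) (z ∙ z′) = cong₂ ℤ._+_
      (trans (ans-cell d w _ z) (trans (had-cong (λ a → rf _ _ (m a) (s , j) (get d a z)) w) (sym (ans-cell d w _ z))))
      (items z′)
      where
      items : ∀ z′ → ans z′ (item u s w j) ≡ ans z′ (item v s w j)
      items z′ with r ≤? weight w
      ... | yes _ = rg u v n _ z′
      ... | no  _ = refl
    learn : ∀ x y → (PowRel d K ⊠ L) x y → (∀ i → ans x (row x i) ≡ ans y (row x i)) → (PowRel d M ⊠ N) x y
    learn (x ∙ u) (y ∙ v) (m , n) e =
      (λ a → kf _ _ (m a) λ (s , j) → copies s j a) , kg u v n (λ (a , j) → found a j)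
      where
      α β : Bool → J → W d → ℤ
      α s j a = ans (get d a x) (f (get d a x) (s , j))
      β s j a = ans (get d a y) (f (get d a x) (s , j))
      ι ι′ : Bool → J → W d → ℤ
      ι s j w = ans u (item u s w j)
      ι′ s j w = ans v (item u s w j)
      balance : ∀ s j w → had (α s j) w ℤ.+ ι s j w ≡ had (β s j) w ℤ.+ ι′ s j w
      balance s j w = trans (cong (ℤ._+ _) (sym (ans-cell d w _ x)))
        (trans (e (s , w , j)) (cong (ℤ._+ _) (ans-cell d w _ y)))
      move : ∀ p q p′ q′ → p ℤ.+ q ≡ p′ ℤ.+ q′ → p ℤ.- p′ ≡ - (q ℤ.- q′)
      move p q p′ q′ eq = i+j≡0⇒i≡-j (p ℤ.- p′) (q ℤ.- q′)
        (trans (lemma p q p′ q′) (ℤₚ.i≡j⇒i-j≡0 eq))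
        where
        lemma : ∀ p q p′ q′ → (p ℤ.- p′) ℤ.+ (q ℤ.- q′) ≡ (p ℤ.+ q) ℤ.- (p′ ℤ.+ q′)
        lemma = solve-∀
      item-small : ∀ s j w → ∣ ι s j w ℤ.- ι′ s j w ∣ < 2 ^ weight w
      item-small s j w with r ≤? weight w
      ... | yes h = ℕₚ.<-≤-trans (og u v n _) (ℕₚ.^-monoʳ-≤ 2 h)
      ... | no  _ = subst (λ i → ∣ i ∣ < 2 ^ weight w)
                      (sym (cong₂ ℤ._-_ (ans-none u) (ans-none v))) (small0 (weight w))
      -- The transform of `α - β` is minus the difference of the item answers. That difference is
      -- below `2 ^ weight w` in every row, so `had-zero` applies.
      copies : ∀ s j a → α s j a ≡ β s j a
      copies s j a = ℤₚ.i-j≡0⇒i≡j (α s j a) (β s j a)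
        (had-zero (λ a → α s j a ℤ.- β s j a) (λ w → subst (_< 2 ^ weight w)
          (sym (trans (cong ∣_∣ (trans (had-sub (α s j) (β s j) w) (move (had (α s j) w) (ι s j w) (had (β s j) w) (ι′ s j w) (balance s j w))))
                      (ℤₚ.∣-i∣≡∣i∣ (ι s j w ℤ.- ι′ s j w))))
          (item-small s j w)) a)
      -- With the copies known, their share can be subtracted from the row, and the item's answer
      -- remains.
      same-item : ∀ s j w → ι s j w ≡ ι′ s j w
      same-item s j w = +-cancelˡ (had (α s j) w)
        (trans (balance s j w) (cong (ℤ._+ ι′ s j w) (sym (had-cong (copies s j) w))))
      read : ∀ s j w → r ≤ weight w → ans u (g u (origin s w , j)) ≡ ans v (g u (origin s w , j))
      read s j w h with r ≤? weight w | same-item s j w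
      ... | yes _ | eq = eq
      ... | no ¬h | _  = ⊥-elim (¬h h)
      found : ∀ a j → ans u (g u (a , j)) ≡ ans v (g u (a , j))
      found a j with heavy-or-flip r a
      ... | inj₁ h = read true j a h
      ... | inj₂ h = subst (λ b → ans u (g u (b , j)) ≡ ans v (g u (b , j))) (flip-flip a) (read false j (flip a) h)

-- Counting colours below the nodes of a tree

one↔ : ⊤ ↔ Fin 1
one↔ = mk↔ₛ′ (λ _ → zero) (λ _ → tt) (λ { zero → refl }) (λ { tt → refl })

W↔Fin : ∀ d → W d ↔ Fin (2 ^ d)
W↔Fin zero    = mk↔ₛ′ (λ _ → zero) (λ _ → []) (λ { zero → refl }) (λ { [] → refl })
W↔Fin (suc d) = ↔-trans cons (↔-trans (↔-sym Finₚ.2↔Bool ×-↔ W↔Fin d) (↔-sym Finₚ.*↔×))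
  where
  cons : W (suc d) ↔ (Bool × W d)
  cons = mk↔ₛ′ (λ { (b ∷ w) → b , w }) (λ { (b , w) → b ∷ w }) (λ _ → refl) (λ { (b ∷ w) → refl })

infixr 5 _×↔Fin_
_×↔Fin_ : ∀ {I J : Set} {m n} → I ↔ Fin m → J ↔ Fin n → (I × J) ↔ Fin (m * n)
i ×↔Fin j = ↔-trans (i ×-↔ j) (↔-sym Finₚ.*↔×)

fits : ∀ {I J : Set} {m n} → I ↔ Fin m → J ↔ Fin n → m ≤ n → I ↣ₚ J
fits {I} {J} {m} {n} i j m≤n = record { into = in′ ; from = back ; from-into = back-in }
  where
  open Inverse
  in′ : I → J
  in′ a = from j (Fin.inject≤ (to i a) m≤n)
  back : J → Maybe I
  back b with Fin.toℕ (to j b) ℕ.<? m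
  ... | yes p = just (from i (Fin.fromℕ< p))
  ... | no  _ = nothing
  same : ∀ a → Fin.toℕ (to j (in′ a)) ≡ Fin.toℕ (to i a)
  same a = trans (cong Fin.toℕ (inverseˡ j refl)) (Finₚ.toℕ-inject≤ (to i a) m≤n)
  back-in : ∀ a → back (in′ a) ≡ just a
  back-in a with Fin.toℕ (to j (in′ a)) ℕ.<? m
  ... | yes p = cong just (inverseʳ i (Finₚ.toℕ-injective (trans (Finₚ.toℕ-fromℕ< p) (same a))))
  ... | no ¬p = ⊥-elim (¬p (subst (_< m) (sym (same a)) (Finₚ.toℕ<n (to i a))))

pick : ∀ {C : Set} → List C → ∀ {N} → Fin N → Maybe C
pick []       i       = nothing
pick (c ∷ cs) zero    = just c
pick (c ∷ cs) (suc i) = pick cs i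

pick-∈ : ∀ {C : Set} (cs : List C) {N} (i : Fin N) {c} → pick cs i ≡ just c → c ∈ cs
pick-∈ (c ∷ cs) zero    refl = here refl
pick-∈ (c ∷ cs) (suc i) eq   = there (pick-∈ cs i eq)

∈-pick : ∀ {C : Set} {c : C} {cs N} → c ∈ cs → length cs ≤ N → Σ (Fin N) λ i → pick cs i ≡ just c
∈-pick (here refl) (s≤s _) = zero , refl
∈-pick (there c∈)  (s≤s p) with ∈-pick c∈ p
... | i , eq = suc i , eq

sum-tabulate-+ : ∀ n (f g : Fin n → ℕ) →
                 sum (tabulate (λ i → f i + g i)) ≡ sum (tabulate f) + sum (tabulate g)
sum-tabulate-+ zero    f g = refl
sum-tabulate-+ (suc n) f g rewrite sum-tabulate-+ n (f ∘ suc) (g ∘ suc) =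
  lemma (f zero) (g zero) (sum (tabulate (f ∘ suc))) (sum (tabulate (g ∘ suc)))
  where
  lemma : ∀ a b c d → (a + b) + (c + d) ≡ (a + c) + (b + d)
  lemma = solveℕ-∀

sum-tabulate-0 : ∀ n → sum (tabulate {n = n} (λ _ → 0)) ≡ 0
sum-tabulate-0 zero    = refl
sum-tabulate-0 (suc n) = sum-tabulate-0 n

sum-indicator : ∀ {n} (a : Fin n) → sum (tabulate (λ c → if does (a Finₚ.≟ c) then 1 else 0)) ≡ 1
sum-indicator {suc n} zero    = cong suc (sum-tabulate-0 n)
sum-indicator {suc n} (suc a) = sum-indicator a

-- Markov's inequality for the counting measure on `cs`.
length-filter-* : ∀ {C : Set} (V : ℕ) (f : C → ℕ) cs →
                  length (filter (λ c → V ≤? f c) cs) * V ≤ sum (List.map f cs)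
length-filter-* V f [] = z≤n
length-filter-* V f (c ∷ cs) = [ accept , reject ]′ (ℕₚ.≤-<-connex V (f c))
  where
  accept : V ≤ f c → length (filter (λ c → V ≤? f c) (c ∷ cs)) * V ≤ sum (List.map f (c ∷ cs))
  accept p rewrite Listₚ.filter-accept (λ c → V ≤? f c) {xs = cs} p = ℕₚ.+-mono-≤ p (length-filter-* V f cs)
  reject : f c < V → length (filter (λ c → V ≤? f c) (c ∷ cs)) * V ≤ sum (List.map f (c ∷ cs))
  reject p rewrite Listₚ.filter-reject (λ c → V ≤? f c) {xs = cs} (ℕₚ.<⇒≱ p) =
    ℕₚ.≤-trans (length-filter-* V f cs) (ℕₚ.m≤n+m _ (f c))

leaves : Shape → ℕ
leaves leaf    = 1
leaves (A ⊗ B) = leaves A + leaves B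

leaves-Pow : ∀ d A → leaves (Pow d A) ≡ 2 ^ d * leaves A
leaves-Pow zero    A = sym (ℕₚ.+-identityʳ _)
leaves-Pow (suc d) A rewrite leaves-Pow d A = lemma (2 ^ d) (leaves A)
  where
  lemma : ∀ p a → p * a + p * a ≡ (2 * p) * a
  lemma = solveℕ-∀

Pow-+ : ∀ d e A → Pow (d + e) A ≡ Pow d (Pow e A)
Pow-+ zero    e A = refl
Pow-+ (suc d) e A = cong₂ _⊗_ (Pow-+ d e A) (Pow-+ d e A)

∣a-b∣<c : ∀ {a b W} → a < W → b < W → ∣ + a ℤ.- + b ∣ < W
∣a-b∣<c {a} {b} p q = ℕₚ.≤-<-trans
  (subst (λ z → ∣ z ∣ ≤ a ℕ.⊔ b) (sym (ℤₚ.m-n≡m⊖n a b)) (ℤₚ.∣m⊝n∣≤m⊔n a b))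
  (ℕₚ.⊔-lub p q)

module Counts (κ : ℕ) where
  open Colours κ public

  cnt : ∀ {A} → Colour → X A → ℕ
  cnt c (lf a)  = ind c a
  cnt c (l ∙ r) = cnt c l + cnt c r

  monochrome : ∀ A → Colour → Q A
  monochrome leaf    c = plus c
  monochrome (A ⊗ B) c = monochrome A c ∙ monochrome B c

  ans-monochrome : ∀ {A} (x : X A) c → ans x (monochrome A c) ≡ + cnt c x ℤ.- + cnt zero x
  ans-monochrome (lf a)  c = refl
  ans-monochrome (l ∙ r) c = trans (cong₂ ℤ._+_ (ans-monochrome l c) (ans-monochrome r c))
    (trans (lemma (+ cnt c l) (+ cnt zero l) (+ cnt c r) (+ cnt zero r))
      (sym (cong₂ ℤ._-_ (ℤₚ.pos-+ (cnt c l) (cnt c r)) (ℤₚ.pos-+ (cnt zero l) (cnt zero r)))))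
    where
    lemma : ∀ a b c d → (a ℤ.- b) ℤ.+ (c ℤ.- d) ≡ (a ℤ.+ c) ℤ.- (b ℤ.+ d)
    lemma = solve-∀

  -- Colour zero is the filling of signed queries. Once its positions agree, monochrome answers
  -- compare the counts of `c` itself.
  SameZeros : ∀ {A} → Rel A
  SameZeros (lf a)  (lf b)    = ind zero a ≡ ind zero b
  SameZeros (l ∙ r) (l′ ∙ r′) = SameZeros l l′ × SameZeros r r′

  SameZeros⇒cnt : ∀ {A} (x y : X A) → SameZeros x y → cnt zero x ≡ cnt zero y
  SameZeros⇒cnt (lf a)  (lf b)    z       = z
  SameZeros⇒cnt (l ∙ r) (l′ ∙ r′) (z , w) = cong₂ _+_ (SameZeros⇒cnt l l′ z) (SameZeros⇒cnt r r′ w)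

  monochrome-diff : ∀ {A} (x y : X A) c → SameZeros x y →
              ans x (monochrome A c) ℤ.- ans y (monochrome A c) ≡ + cnt c x ℤ.- + cnt c y
  monochrome-diff x y c z rewrite ans-monochrome x c | ans-monochrome y c | SameZeros⇒cnt x y z =
    lemma (+ cnt c x) (+ cnt c y) (+ cnt zero y)
    where
    lemma : ∀ a b z → (a ℤ.- z) ℤ.- (b ℤ.- z) ≡ a ℤ.- b
    lemma = solve-∀

  monochrome⇒cnt : ∀ {A} (x y : X A) c → SameZeros x y → ans x (monochrome A c) ≡ ans y (monochrome A c) → cnt c x ≡ cnt c y
  monochrome⇒cnt x y c z eq = ℤₚ.+-injective (ℤₚ.i-j≡0⇒i≡j (+ cnt c x) (+ cnt c y)
    (trans (sym (monochrome-diff x y c z)) (ℤₚ.i≡j⇒i-j≡0 eq)))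

  sum-cnt : ∀ {A} (x : X A) → sum (List.map (λ c → cnt c x) (allFin _)) ≡ leaves A
  sum-cnt x = trans (cong sum (Listₚ.map-tabulate (λ i → i) (λ c → cnt c x))) (go x)
    where
    go : ∀ {A} (x : X A) → sum (tabulate (λ c → cnt c x)) ≡ leaves A
    go (lf a)  = sum-indicator a
    go (l ∙ r) = trans (sum-tabulate-+ _ (λ c → cnt c l) (λ c → cnt c r)) (cong₂ _+_ (go l) (go r))

  cnt≤leaves : ∀ {A} c (x : X A) → cnt c x ≤ leaves A
  cnt≤leaves c (lf a) with does (a Finₚ.≟ c)
  ... | true  = s≤s z≤n
  ... | false = z≤n
  cnt≤leaves c (l ∙ r) = ℕₚ.+-mono-≤ (cnt≤leaves c l) (cnt≤leaves c r)

  heavy : ∀ {A} → ℕ → X A → List Colour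
  heavy V x = filter (λ c → V ≤? cnt c x) (allFin _)

  heavy-few : ∀ {A} V N (x : X A) → leaves A < V * suc N → length (heavy V x) ≤ N
  heavy-few {A} V N x small = ℕₚ.≤-pred (ℕₚ.*-cancelʳ-< V _ _ (ℕₚ.≤-<-trans
    (ℕₚ.≤-trans (length-filter-* V (λ c → cnt c x) (allFin _)) (ℕₚ.≤-reflexive (sum-cnt x)))
    (subst (leaves A <_) (ℕₚ.*-comm V (suc N)) small)))

  -- The counts of `c` agree down the tree as far as they stay at least `V`, and also at the
  -- children of the last such nodes.
  Refined : ∀ {A} → ℕ → Colour → Rel A
  Refined V c (lf a)  (lf b)    = ind c a ≡ ind c b
  Refined V c (l ∙ r) (l′ ∙ r′) = cnt c (l ∙ r) ≡ cnt c (l′ ∙ r′)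
    × (V ≤ cnt c (l ∙ r) → Refined V c l l′ × Refined V c r r′)

  Refined⇒cnt : ∀ {A V c} (x y : X A) → Refined V c x y → cnt c x ≡ cnt c y
  Refined⇒cnt (lf a)  (lf b)    k       = k
  Refined⇒cnt (l ∙ r) (l′ ∙ r′) (k , _) = k

  light⇒Refined : ∀ {A V c} (x y : X A) → cnt c x ≡ cnt c y → cnt c x < V → Refined V c x y
  light⇒Refined (lf a)  (lf b)    eq _ = eq
  light⇒Refined (l ∙ r) (l′ ∙ r′) eq p = eq , λ q → ⊥-elim (ℕₚ.<⇒≱ p q)

  HeavyIn : ∀ {A} → ℕ → Colour → X A → X A → Set
  HeavyIn V c x y = V ≤ cnt c x ⊎ V ≤ cnt c y

  -- Besides the positions of colour zero, this concerns only colours that occur at least `V` times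
  -- in one of the two codes; nothing is asserted about lighter ones.
  Know : ∀ {A} → ℕ → ℕ → Rel A
  Know V V′ x y = SameZeros x y × (∀ c → HeavyIn V c x y → Refined V′ c x y)

  Counted : ∀ {A B} → ℕ → Rel (A ⊗ B)
  Counted V (l ∙ r) (l′ ∙ r′) = ∀ c → HeavyIn V c (l ∙ r) (l′ ∙ r′) → cnt c l ≡ cnt c l′ × cnt c r ≡ cnt c r′

  -- A colour heavy at the node has equal counts in each child. Where it is still heavy, the child's
  -- knowledge covers it; where it is light, the count alone suffices.
  join : ∀ {A B V} (x y : X (A ⊗ B)) → Counted V x y → (Know V V ⊠ Know V V) x y → Know V V x y
  join {V = V} (l ∙ r) (l′ ∙ r′) s ((z , k) , (w , m)) = (z , w) , λ c h →
    let (el , er) = s c h in cong₂ _+_ el er , λ _ → half k el , half m er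
    where
    half : ∀ {A c} {x y : X A} → (∀ c → HeavyIn V c x y → Refined V c x y) → cnt c x ≡ cnt c y → Refined V c x y
    half {c = c} {x} {y} k e with V ≤? cnt c x
    ... | yes p = k c (inj₁ p)
    ... | no ¬p = light⇒Refined x y e (ℕₚ.≰⇒> ¬p)

  small⇒Know : ∀ {A V V′ V″} (x y : X A) → leaves A < V → Know V V′ x y → Know V V″ x y
  small⇒Know x y p (z , _) = z , λ
    { c (inj₁ h) → ⊥-elim (ℕₚ.<⇒≱ p (ℕₚ.≤-trans h (cnt≤leaves c x)))
    ; c (inj₂ h) → ⊥-elim (ℕₚ.<⇒≱ p (ℕₚ.≤-trans h (cnt≤leaves c y))) }

  -- Makes the queries of `splitOne` admissible: codes not yet told apart have the same list of
  -- heavy colours.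
  heavy-cong : ∀ {A V V′} (x y : X A) → Know V V′ x y → heavy V x ≡ heavy V y
  heavy-cong {V = V} x y (z , k) = Listₚ.filter-≐ (λ c → V ≤? cnt c x) (λ c → V ≤? cnt c y)
    ( (λ {c} p → subst (V ≤_) (Refined⇒cnt x y (k c (inj₁ p))) p)
    , (λ {c} p → subst (V ≤_) (sym (Refined⇒cnt x y (k c (inj₂ p)))) p)) (allFin _)

  -- For each heavy colour the count below the left child is asked; the right one follows by
  -- subtraction. If the colour occurs at least `2 ^ r` times, its child counts agree already;
  -- otherwise they are below `2 ^ r`. Either way the answers of codes not yet told apart differ by
  -- less than `2 ^ r`.
  splitOne : ∀ {A B J} V r τ N → leaves (A ⊗ B) < V * suc N → Fin N ↣ₚ (Fin τ × J) →
             Proc (A ⊗ B) (Small r) J (λ x y → Counted V x y × (Know V (2 ^ r) ⊠ Know V (2 ^ r)) x y)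
               τ (Know V (2 ^ r))
  splitOne {A} {B} {J} V r τ N small ι = post learn (chunked τ f resp ok)
    where
    V′ = 2 ^ r
    item : Maybe Colour → Q (A ⊗ B)
    item = maybe′ (λ c → monochrome A c ∙ none B) (none (A ⊗ B))
    slot : List Colour → Fin τ → J → Maybe Colour
    slot cs s j = from ι (s , j) >>= pick cs
    f : X (A ⊗ B) → Fin τ → J → Q (A ⊗ B)
    f x s j = item (slot (heavy V x) s j)
    resp : ∀ x y → Know V V′ x y → ∀ s j z → ans z (f x s j) ≡ ans z (f y s j)
    resp x y k s j z = cong (λ cs → ans z (item (slot cs s j))) (heavy-cong x y k)
    slot-∈ : ∀ cs s j {c} → slot cs s j ≡ just c → c ∈ cs
    slot-∈ cs s j eq with from ι (s , j)
    ... | just i = pick-∈ cs i eq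
    item-ans : ∀ l r c → ans (l ∙ r) (item (just c)) ≡ ans l (monochrome A c)
    item-ans l r c = trans (cong (λ s → ans l (monochrome A c) ℤ.+ s) (ans-none r)) (ℤₚ.+-identityʳ _)
    ok : ∀ x y → Know V V′ x y → ∀ s j → Small r (ans x (f x s j) ℤ.- ans y (f x s j))
    ok (l ∙ u) (l′ ∙ u′) ((z , w) , k) s j with slot (heavy V (l ∙ u)) s j in eq
    ... | nothing = subst (Small r) (sym (cong₂ ℤ._-_ (ans-none (l ∙ u)) (ans-none (l′ ∙ u′)))) (small0 r)
    ... | just c  = subst (Small r)
          (sym (trans (cong₂ ℤ._-_ (item-ans l u c) (item-ans l′ u′ c)) (monochrome-diff l l′ c z))) (bound (k c (inj₁ hc)))
      where
      hc : V ≤ cnt c (l ∙ u)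
      hc = proj₂ (∈-filter⁻ (λ c → V ≤? cnt c (l ∙ u)) {xs = allFin _} (slot-∈ (heavy V (l ∙ u)) s j eq))
      bound : Refined V′ c (l ∙ u) (l′ ∙ u′) → Small r (+ cnt c l ℤ.- + cnt c l′)
      bound (e , m) with V′ ≤? cnt c (l ∙ u)
      ... | yes p = subst (Small r) (sym (ℤₚ.i≡j⇒i-j≡0 (cong +_ (Refined⇒cnt l l′ (proj₁ (m p)))))) (small0 r)
      ... | no ¬p = ∣a-b∣<c {cnt c l} {cnt c l′} (ℕₚ.≤-<-trans (ℕₚ.m≤m+n (cnt c l) (cnt c u)) (ℕₚ.≰⇒> ¬p))
                            (ℕₚ.≤-<-trans (ℕₚ.m≤m+n (cnt c l′) (cnt c u′)) (subst (_< V′) e (ℕₚ.≰⇒> ¬p)))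
    learn : ∀ x y → Know V V′ x y × (∀ s j → ans x (f x s j) ≡ ans y (f x s j)) →
            Counted V x y × (Know V V′ ⊠ Know V V′) x y
    learn (l ∙ u) (l′ ∙ u′) (((z , w) , k) , e) = counted , (z , child-l) , (w , child-r)
      where
      hx = heavy V (l ∙ u)
      sideways : ∀ c → HeavyIn V c (l ∙ u) (l′ ∙ u′) → V ≤ cnt c (l ∙ u)
      sideways c (inj₁ h) = h
      sideways c (inj₂ h) = subst (V ≤_) (sym (Refined⇒cnt _ _ (k c (inj₂ h)))) h
      count-l : ∀ c → V ≤ cnt c (l ∙ u) → cnt c l ≡ cnt c l′
      count-l c h with ∈-pick (∈-filter⁺ (λ c → V ≤? cnt c (l ∙ u)) (∈-allFin c) h) (heavy-few V N (l ∙ u) small)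
      ... | i , pi = monochrome⇒cnt l l′ c z (trans (sym (item-ans l u c)) (trans
              (subst (λ q → ans (l ∙ u) (item q) ≡ ans (l′ ∙ u′) (item q)) found (e _ _)) (item-ans l′ u′ c)))
        where
        found : slot hx (proj₁ (into ι i)) (proj₂ (into ι i)) ≡ just c
        found rewrite from-into ι i = pi
      counted : Counted V (l ∙ u) (l′ ∙ u′)
      counted c h = el , ℕₚ.+-cancelˡ-≡ (cnt c l) _ _
          (trans (Refined⇒cnt (l ∙ u) (l′ ∙ u′) (k c h)) (cong (_+ cnt c u′) (sym el)))
        where
        el = count-l c (sideways c h)
      descend : ∀ {D} (x y : X D) c → HeavyIn V c (l ∙ u) (l′ ∙ u′) → cnt c x ≡ cnt c y → cnt c x ≤ cnt c (l ∙ u) →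
                (Refined V′ c l l′ × Refined V′ c u u′ → Refined V′ c x y) → Refined V′ c x y
      descend x y c h e′ le sel with V′ ≤? cnt c (l ∙ u)
      ... | yes p = sel (proj₂ (k c h) p)
      ... | no ¬p = light⇒Refined x y e′ (ℕₚ.≤-<-trans le (ℕₚ.≰⇒> ¬p))
      up : ∀ {a b a′ b′} → V ≤ a ⊎ V ≤ b → a ≤ a′ → b ≤ b′ → V ≤ a′ ⊎ V ≤ b′
      up (inj₁ p) q _ = inj₁ (ℕₚ.≤-trans p q)
      up (inj₂ p) _ q = inj₂ (ℕₚ.≤-trans p q)
      child-l : ∀ c → HeavyIn V c l l′ → Refined V′ c l l′
      child-l c h = let h′ = up h (ℕₚ.m≤m+n _ _) (ℕₚ.m≤m+n _ _) in
        descend l l′ c h′ (proj₁ (counted c h′)) (ℕₚ.m≤m+n _ _) proj₁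
      child-r : ∀ c → HeavyIn V c u u′ → Refined V′ c u u′
      child-r c h = let h′ = up h (ℕₚ.m≤n+m _ _) (ℕₚ.m≤n+m _ _) in
        descend u u′ c h′ (proj₂ (counted c h′)) (ℕₚ.m≤n+m _ _) proj₂

-- One phase: following the colours of one order of magnitude

Doubled : Set → ℕ → Set
Doubled I zero    = I
Doubled I (suc h) = W 1 × Doubled I h

Doubled↔Fin : ∀ {I β} → I ↔ Fin β → ∀ h → Doubled I h ↔ Fin (2 ^ h * β)
Doubled↔Fin {I} {β} ι zero    = subst (λ m → I ↔ Fin m) (sym (ℕₚ.+-identityʳ β)) ι
Doubled↔Fin {I} {β} ι (suc h) = subst (λ m → Doubled I (suc h) ↔ Fin m) (sym (ℕₚ.*-assoc 2 (2 ^ h) β))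
  (W↔Fin 1 ×↔Fin Doubled↔Fin ι h)

module Splitting (κ ρ : ℕ) where
  open Counts κ

  V r : ℕ
  V = 2 ^ ρ
  r = suc ρ

  -- Knowledge before and after a phase: the counts of a colour are followed down the tree as long as
  -- they are at least 2 V, respectively V.
  E O : ∀ {A} → Rel A
  E = Know V (2 ^ r)
  O = Know V V

  -- The counts learnt above the blocks are kept in the form of the implication that they are needed
  -- for.
  Split : ∀ A h → Rel (Pow h A)
  Split A h x y = PowRel h E x y × (PowRel h O x y → O x y)

  module _ {I : Set} (A : Shape) (n β τ : ℕ) (ι : I ↔ Fin β) (small : leaves A ≤ V * n) (room : n ≤ τ * β) where

    size-bound : ∀ h → leaves (Pow h A) < V * suc (2 ^ h * n)
    size-bound h = begin-strict
      leaves (Pow h A)    ≡⟨ leaves-Pow h A ⟩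
      2 ^ h * leaves A    ≤⟨ ℕₚ.*-monoʳ-≤ (2 ^ h) small ⟩
      2 ^ h * (V * n)     ≡⟨ lemma (2 ^ h) V n ⟩
      V * (2 ^ h * n)     <⟨ ℕₚ.*-monoʳ-< V {{ℕ.>-nonZero (ℕₚ.m^n>0 2 ρ)}} (ℕₚ.n<1+n _) ⟩
      V * suc (2 ^ h * n) ∎
      where
      open ℕₚ.≤-Reasoning
      lemma : ∀ p v n → p * (v * n) ≡ v * (p * n)
      lemma = solveℕ-∀

    slots : ∀ h → Fin (2 ^ h * n) ↣ₚ (Fin τ × Doubled I h)
    slots h = fits ↔-refl (↔-refl ×↔Fin Doubled↔Fin ι h) (begin
      2 ^ h * n       ≤⟨ ℕₚ.*-monoʳ-≤ (2 ^ h) room ⟩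
      2 ^ h * (τ * β) ≡⟨ lemma (2 ^ h) τ β ⟩
      τ * (2 ^ h * β) ∎)
      where
      open ℕₚ.≤-Reasoning
      lemma : ∀ p t b → p * (t * b) ≡ t * (p * b)
      lemma = solveℕ-∀

    -- A node `h` levels above the blocks has at most `2 ^ h * n` heavy colours and pools the
    -- queries of its `2 ^ h` blocks, so every level takes `τ` rounds.
    splitAll : ∀ h → Proc (Pow h A) (Small r) (Doubled I h) (Split A h) (h * τ) E
    splitAll zero    = stop λ x y e → (λ { [] → e }) , λ o → o []
    splitAll (suc h) =
      splitOne V r τ (2 ^ suc h * n) (size-bound (suc h)) (slots (suc h)) ⨾
      post assemble (pre spread (frame (Counted V) (parallel 1 (splitAll h))))
      where
      spread : ∀ (x y : X (Pow (suc h) A)) → Counted V x y × (E ⊠ E) x y → PowRel {Pow h A} 1 E x y × Counted V x y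
      spread (l ∙ u) (l′ ∙ u′) (c , e , e′) = (λ { (true ∷ []) → e ; (false ∷ []) → e′ }) , c
      assemble : ∀ (x y : X (Pow (suc h) A)) → PowRel {Pow h A} 1 (Split A h) x y × Counted V x y → Split A (suc h) x y
      assemble (l ∙ u) (l′ ∙ u′) (m , c) =
        (λ { (true ∷ a) → proj₁ (m (true ∷ [])) a ; (false ∷ a) → proj₁ (m (false ∷ [])) a }) ,
        λ o → join (l ∙ u) (l′ ∙ u′) c
          (proj₂ (m (true ∷ [])) (o ∘ (true ∷_)) , proj₂ (m (false ∷ [])) (o ∘ (false ∷_)))

  -- A tree of height `j + ρ` has at most `2 ^ j` heavy colours, matched by `2 ^ j` queries per
  -- round, so each level takes one round. Below height `ρ` nodes have fewer than `V` leaves and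
  -- nothing is left to count.
  base : ∀ j → Proc (Pow (j + ρ) leaf) (Small r) (Doubled ⊤ j) O (suc j) E
  base zero = small-node ρ refl
    where
    small-node : ∀ d → d ≡ ρ → Proc (Pow d leaf) (Small r) ⊤ O 1 E
    small-node zero    _  = idle (small0 r) (λ { (lf _) (lf _) (z , k) → z , k }) 1
    small-node (suc d) eq =
      post (λ { x@(l ∙ u) y@(l′ ∙ u′) (c , e , e′) → join x y c (small⇒Know l l′ tiny e , small⇒Know u u′ tiny e′) })
        (splitOne V r 1 1 whole (fits ↔-refl (↔-refl ×↔Fin one↔) (ℕₚ.≤-refl {1})))
      where
      size : leaves (Pow d leaf) ≡ 2 ^ d
      size = trans (leaves-Pow d leaf) (ℕₚ.*-identityʳ _)
      tiny : leaves (Pow d leaf) < V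
      tiny = subst₂ _<_ (sym size) (cong (2 ^_) eq) (ℕₚ.^-monoʳ-< 2 (s≤s (s≤s z≤n)) (ℕₚ.n<1+n d))
      whole : leaves (Pow d leaf) + leaves (Pow d leaf) < V * 2
      whole = subst (leaves (Pow d leaf) + leaves (Pow d leaf) <_) (lemma V) (ℕₚ.+-mono-< tiny tiny)
        where
        lemma : ∀ v → v + v ≡ v * 2
        lemma = solveℕ-∀
  base (suc j) =
    splitOne V r 1 (2 ^ suc j) small (fits ↔-refl (↔-refl ×↔Fin Doubled↔Fin one↔ (suc j)) le) ⨾
    post (λ { x@(l ∙ u) y@(l′ ∙ u′) (m , c) → join x y c (m (true ∷ []) , m (false ∷ [])) })
      (pre (λ { (l ∙ u) (l′ ∙ u′) (c , e , e′) → (λ { (true ∷ []) → e ; (false ∷ []) → e′ }) , c })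
        (frame (Counted V) (parallel 1 (base j))))
    where
    le : 2 ^ suc j ≤ 1 * (2 ^ suc j * 1)
    le = ℕₚ.≤-reflexive (lemma (2 ^ suc j))
      where
      lemma : ∀ a → a ≡ 1 * (a * 1)
      lemma = solveℕ-∀
    small : leaves (Pow (suc j + ρ) leaf) < V * suc (2 ^ suc j)
    small = begin-strict
      leaves (Pow (suc j + ρ) leaf) ≡⟨ trans (leaves-Pow (suc j + ρ) leaf) (ℕₚ.*-identityʳ _) ⟩
      2 ^ (suc j + ρ)               ≡⟨ ℕₚ.^-distribˡ-+-* 2 (suc j) ρ ⟩
      2 ^ suc j * V                 ≡⟨ ℕₚ.*-comm (2 ^ suc j) V ⟩
      V * 2 ^ suc j                 <⟨ ℕₚ.*-monoʳ-< V {{ℕ.>-nonZero (ℕₚ.m^n>0 2 ρ)}} (ℕₚ.n<1+n _) ⟩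
      V * suc (2 ^ suc j)           ∎
      where open ℕₚ.≤-Reasoning

module Phase (κ ρ j : ℕ) (j≤ : j ≤ suc ρ + suc ρ) where
  open Counts κ
  open Splitting κ ρ public

  -- `2 ^ g` blocks form two halves of `4 ^ r` blocks each, the size of the transform in `merge`.
  g : ℕ
  g = suc (r + r)

  G : ℕ → Shape
  G zero    = Pow (j + ρ) leaf
  G (suc i) = Pow g (G i)

  b : ℕ → ℕ
  b zero    = 2 ^ j
  b (suc i) = 2 ^ (r + r) * b i

  J : ℕ → Set
  J zero    = Fin (2 * 2 ^ j)
  J (suc i) = W (r + r) × J i

  J↔Fin : ∀ i → J i ↔ Fin (2 * b i)
  J↔Fin zero    = ↔-refl
  J↔Fin (suc i) = subst (λ m → J (suc i) ↔ Fin m) (lemma (2 ^ (r + r)) (b i)) (W↔Fin (r + r) ×↔Fin J↔Fin i)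
    where
    lemma : ∀ p b → p * (2 * b) ≡ 2 * (p * b)
    lemma = solveℕ-∀

  leaves-G : ∀ i → leaves (G i) ≡ V * (2 ^ i * b i)
  leaves-G zero = begin
    leaves (Pow (j + ρ) leaf) ≡⟨ trans (leaves-Pow (j + ρ) leaf) (ℕₚ.*-identityʳ _) ⟩
    2 ^ (j + ρ)               ≡⟨ ℕₚ.^-distribˡ-+-* 2 j ρ ⟩
    2 ^ j * V                 ≡⟨ lemma (2 ^ j) V ⟩
    V * (1 * 2 ^ j)           ∎
    where
    open ≡-Reasoning
    lemma : ∀ a v → a * v ≡ v * (1 * a)
    lemma = solveℕ-∀
  leaves-G (suc i) = trans (leaves-Pow g (G i)) (trans (cong (2 ^ g *_) (leaves-G i))
    (lemma (2 ^ (r + r)) V (2 ^ i) (b i)))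
    where
    lemma : ∀ p v t b → (2 * p) * (v * (t * b)) ≡ v * ((2 * t) * (p * b))
    lemma = solveℕ-∀

  -- Only the blocks in the left half are prepared; those in the right half are prepared by the items
  -- while the left half is being solved. The last component preserves the counts learnt on the way.
  Pre : ∀ i → Rel (G i)
  Pre zero            = E
  Pre (suc i) x y = (PowRel (r + r) (Pre i) ⊠ PowRel (r + r) E) x y × (PowRel {G i} g O x y → O x y)

  -- From `i` to `suc i` the rounds double and the queries per round grow by `4 ^ r`, while the
  -- leaves grow by `2 * 4 ^ r`: the number of queries per leaf is constant.
  steps : ℕ → ℕ
  steps i = g * 2 ^ i

  steps-suc : ∀ i → steps i + steps i ≡ steps (suc i)
  steps-suc i = lemma g (2 ^ i)
    where
    lemma : ∀ g t → g * t + g * t ≡ g * (2 * t)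
    lemma = solveℕ-∀

  prework : ∀ i → Proc (G i) (Small r) (J i) (Pre i) (steps i) E
  prework zero    = idle (small0 r) (λ _ _ e → e) (steps zero)
  prework (suc i) = subst (λ t → Proc (G (suc i)) (Small r) (J (suc i)) (Pre (suc i)) t E) (steps-suc i)
    -- The `g` levels of splitting take `2 ^ i` rounds each, which is `steps i` in all; preparing
    -- the left half takes another `steps i`.
    (reindex (small0 r) wide (splitAll (G i) (2 ^ i * b i) (b i) (2 ^ i) (↔-refl {A = Fin (b i)})
        (ℕₚ.≤-reflexive (leaves-G i)) ℕₚ.≤-refl g) ⨾
     pre spread (frame Up (left (PowRel (r + r) E) (parallel (r + r) (prework i)))))
    where
    Up : Rel (G (suc i))
    Up x y = PowRel {G i} g O x y → O x y
    wide : Doubled (Fin (b i)) g ↣ₚ J (suc i)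
    wide = fits (Doubled↔Fin ↔-refl g) (J↔Fin (suc i)) (ℕₚ.≤-reflexive (ℕₚ.*-assoc 2 (2 ^ (r + r)) (b i)))
    spread : ∀ (x y : X (G (suc i))) → Split (G i) g x y → (PowRel (r + r) E ⊠ PowRel (r + r) E) x y × Up x y
    spread (l ∙ u) (l′ ∙ u′) (m , up) = ((m ∘ (true ∷_)) , (m ∘ (false ∷_))) , up

  solve : ∀ i → Proc (G i) Any (Bool × J i) O (steps i) (Pre i)
  solve zero    = pad tt enough (reindex tt wide (okMap (λ _ _ _ → tt) (base j)))
    where
    -- The bound on `j` is chosen so that the rounds of `base` fit into `steps zero`.
    enough : suc j ≤ g * 1
    enough = ℕₚ.≤-trans (s≤s j≤) (ℕₚ.≤-reflexive (sym (ℕₚ.*-identityʳ g)))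
    wide : Doubled ⊤ j ↣ₚ (Bool × J zero)
    wide = fits (Doubled↔Fin one↔ j) (↔-sym Finₚ.2↔Bool ×↔Fin J↔Fin zero)
      (ℕₚ.≤-trans (ℕₚ.≤-reflexive (ℕₚ.*-identityʳ (2 ^ j))) (ℕₚ.≤-trans (ℕₚ.m≤m+n (2 ^ j) _) (ℕₚ.m≤m+n _ _)))
  solve (suc i) = subst (λ t → Proc (G (suc i)) Any (Bool × J (suc i)) O t (Pre (suc i))) (steps-suc i)
    (post (λ { (l ∙ u) (l′ ∙ u′) ((o , o′) , up) → up λ { (true ∷ a) → o a ; (false ∷ a) → o′ a } })
      (frame Up
        -- The left half is solved while the items prepare the right half; then the right half is
        -- solved, with blank items.
        (merge r (solve i) (parallel (r + r) (prework i)) ⨾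
         swapped (merge r (solve i) (idle {K = PowRel (r + r) O} (small0 r) (λ _ _ o → o) (steps i))))))
    where
    Up : Rel (G (suc i))
    Up x y = PowRel {G i} g O x y → O x y

  rows : ℕ → ℕ
  rows i = steps i * (2 * b i) + steps i * (2 * (2 * b i))

  phase : ∀ i → Proc (G i) Any ⊤ O (rows i) E
  phase i = flatten _ (J↔Fin i) (okMap (λ _ _ _ → tt) (prework i)) ⨾
            flatten _ (↔-sym Finₚ.2↔Bool ×↔Fin J↔Fin i) (solve i)

  -- 6 = 2 + 4: per round, `prework` asks `2 * b i` queries and `solve` twice as many.
  rows-leaves : ∀ i → rows i * V ≡ 6 * g * leaves (G i)
  rows-leaves i = trans (lemma g (2 ^ i) (b i) V) (cong (6 * g *_) (sym (leaves-G i)))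
    where
    lemma : ∀ g t b v → (g * t * (2 * b) + g * t * (2 * (2 * b))) * v
                        ≡ 6 * g * (v * (t * b))
    lemma = solveℕ-∀

  G-Pow : ∀ i → G i ≡ Pow (j + i * g + ρ) leaf
  G-Pow i = trans (go i) (cong (λ d → Pow d leaf) (lemma i g j ρ))
    where
    lemma : ∀ i g j ρ → i * g + (j + ρ) ≡ j + i * g + ρ
    lemma = solveℕ-∀
    go : ∀ i → G i ≡ Pow (i * g + (j + ρ)) leaf
    go zero    = refl
    go (suc i) = trans (cong (Pow g) (go i)) (trans (sym (Pow-+ g (i * g + (j + ρ)) leaf))
      (cong (λ d → Pow d leaf) (sym (ℕₚ.+-assoc g (i * g) (j + ρ)))))

-- Solving one block by running through the phases

module Block (κ : ℕ) where
  open Counts κ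

  -- Division with remainder, `D ∸ ρ = j + i * g` with `j < g`, presents the tree of height `D` as
  -- `G i`.
  phase-at : ∀ ρ D → ρ ≤ D → Σ ℕ λ L → L * 2 ^ ρ ≡ 6 * (2 * ρ + 3) * 2 ^ D ×
             Proc (Pow D leaf) Any ⊤ (Know (2 ^ ρ) (2 ^ ρ)) L (Know (2 ^ ρ) (2 ^ suc ρ))
  phase-at ρ D ρ≤D = rows i , rows-eq , subst (λ A → Proc A Any ⊤ O (rows i) E) G≡ (phase i)
    where
    base′ = suc (suc ρ + suc ρ)
    q = D ∸ ρ
    j = q DivMod.% base′
    i = q DivMod./ base′
    open Phase κ ρ j (ℕₚ.≤-pred (DivMod.m%n<n q base′))
    G≡ : G i ≡ Pow D leaf
    G≡ = trans (G-Pow i) (cong (λ d → Pow d leaf)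
      (trans (cong (_+ ρ) (sym (DivMod.m≡m%n+[m/n]*n q base′))) (ℕₚ.m∸n+n≡m ρ≤D)))
    rows-eq : rows i * V ≡ 6 * (2 * ρ + 3) * 2 ^ D
    rows-eq = trans (rows-leaves i) (cong₂ _*_ (lemma ρ)
      (trans (cong leaves G≡) (trans (leaves-Pow D leaf) (ℕₚ.*-identityʳ _))))
      where
      lemma : ∀ ρ → 6 * suc (suc ρ + suc ρ) ≡ 6 * (2 * ρ + 3)
      lemma = solveℕ-∀

  Full : ∀ {A} → Rel A
  Full _ _ = ⊤

  SameCounts : ∀ {A} → Rel A
  SameCounts x y = ∀ c → cnt c x ≡ cnt c y

  AllRefined : ∀ {A} → ℕ → Rel A
  AllRefined V x y = SameZeros x y × (∀ c → Refined V c x y)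

  -- The second summand comes from Σ_{ρ ≥ m} (2 ρ + 3) / 2 ^ ρ = (4 m + 10) / 2 ^ m.
  phases : ∀ m D → m ≤ suc D → Σ ℕ λ L → L * 2 ^ m + 6 * (4 * m + 10) * 2 ^ D ≤ 60 * 2 ^ D * 2 ^ m ×
           Proc (Pow D leaf) Any ⊤ (AllRefined 1) L (AllRefined (2 ^ m))
  phases zero    D _   = 0 , ℕₚ.≤-reflexive (sym (ℕₚ.*-identityʳ (60 * 2 ^ D))) , stop λ _ _ k → k
  phases (suc m) D m≤D = ℓ + L , bound , (post raise (pre lower (frame SameCounts (proj₂ (proj₂ first)))) ⨾ proj₂ (proj₂ rest))
    where
    first = phase-at m D (ℕₚ.≤-pred m≤D)
    rest = phases m D (ℕₚ.m≤n⇒m≤1+n (ℕₚ.≤-pred m≤D))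
    ℓ = proj₁ first
    L = proj₁ rest
    ℓ-eq = proj₁ (proj₂ first)
    L-le = proj₁ (proj₂ rest)
    V = 2 ^ m
    s = 2 ^ D
    lower : ∀ (x y : X (Pow D leaf)) → AllRefined (2 ^ suc m) x y → Know V (2 ^ suc m) x y × SameCounts x y
    lower x y (z , k) = (z , λ c _ → k c) , λ c → Refined⇒cnt x y (k c)
    -- The total counts are carried through the phase for the colours that `Know` leaves out: these
    -- occur fewer than `V` times, so `Refined` demands only their totals.
    raise : ∀ (x y : X (Pow D leaf)) → Know V V x y × SameCounts x y → AllRefined V x y
    raise x y ((z , k) , e) = z , λ c → [ (λ h → k c (inj₁ h)) , light⇒Refined x y (e c) ]′ (ℕₚ.≤-<-connex V (cnt c x))
    bound : (ℓ + L) * (2 * V) + 6 * (4 * suc m + 10) * s ≤ 60 * s * (2 * V)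
    bound = begin
      (ℓ + L) * (2 * V) + 6 * (4 * suc m + 10) * s
        ≡⟨ lemma₁ ℓ L V (6 * (4 * suc m + 10) * s) ⟩
      2 * (ℓ * V) + (2 * (L * V) + 6 * (4 * suc m + 10) * s)
        ≡⟨ cong (λ z → 2 * z + (2 * (L * V) + 6 * (4 * suc m + 10) * s)) ℓ-eq ⟩
      2 * (6 * (2 * m + 3) * s) + (2 * (L * V) + 6 * (4 * suc m + 10) * s)
        ≡⟨ lemma₂ 6 (L * V) m s ⟩
      2 * (L * V + 6 * (4 * m + 10) * s)
        ≤⟨ ℕₚ.*-monoʳ-≤ 2 L-le ⟩
      2 * (60 * s * V)
        ≡⟨ lemma₃ 60 s V ⟩
      60 * s * (2 * V) ∎
      where
      open ℕₚ.≤-Reasoning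
      lemma₁ : ∀ ℓ L V a → (ℓ + L) * (2 * V) + a ≡ 2 * (ℓ * V) + (2 * (L * V) + a)
      lemma₁ = solveℕ-∀
      lemma₂ : ∀ c p m s → 2 * (c * (2 * m + 3) * s) + (2 * p + c * (4 * suc m + 10) * s) ≡
               2 * (p + c * (4 * m + 10) * s)
      lemma₂ = solveℕ-∀
      lemma₃ : ∀ a s V → 2 * (a * s * V) ≡ a * s * (2 * V)
      lemma₃ = solveℕ-∀

  -- At threshold 1 a colour is followed to all of its leaves, and a colour absent below a node has
  -- count 0 in both children.
  Refined⇒≡ : ∀ {A} (x y : X A) → (∀ c → Refined 1 c x y) → x ≡ y
  Refined⇒≡ (lf a) (lf b) k = cong lf (decide (trans (sym (ind-refl a)) (k a)))
    where
    ind-refl : ∀ a → ind a a ≡ 1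
    ind-refl a with a Finₚ.≟ a
    ... | yes _ = refl
    ... | no ¬p = ⊥-elim (¬p refl)
    decide : 1 ≡ ind a b → a ≡ b
    decide e with b Finₚ.≟ a
    ... | yes p = sym p
    decide () | no _
  Refined⇒≡ (l ∙ r) (l′ ∙ r′) k = cong₂ _∙_ (Refined⇒≡ l l′ (proj₁ ∘ child)) (Refined⇒≡ r r′ (proj₂ ∘ child))
    where
    child : ∀ c → Refined 1 c l l′ × Refined 1 c r r′
    child c with 1 ≤? cnt c (l ∙ r)
    ... | yes p = proj₂ (k c) p
    ... | no ¬p = light⇒Refined l l′ (trans l0 (sym l′0)) (subst (_< 1) (sym l0) (s≤s z≤n)) ,
                  light⇒Refined r r′ (trans r0 (sym r′0)) (subst (_< 1) (sym r0) (s≤s z≤n))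
      where
      all0 : cnt c l + cnt c r ≡ 0
      all0 = ℕₚ.n<1⇒n≡0 (ℕₚ.≰⇒> ¬p)
      all′0 : cnt c l′ + cnt c r′ ≡ 0
      all′0 = trans (sym (proj₁ (k c))) all0
      l0 = ℕₚ.m+n≡0⇒m≡0 (cnt c l) all0
      r0 = ℕₚ.m+n≡0⇒n≡0 (cnt c l) all0
      l′0 = ℕₚ.m+n≡0⇒m≡0 (cnt c l′) all′0
      r′0 = ℕₚ.m+n≡0⇒n≡0 (cnt c l′) all′0

  -- Colour one measured against colour zero at a single position gives -1 exactly if the position
  -- has colour zero.
  zeros : ∀ D → Proc (Pow D leaf) Any (W D × ⊤) SameZeros 1 Full
  zeros D = post (collect D) (pre (λ _ _ _ _ → tt) (parallel D single))
    where
    compare : ∀ (a b : Colour) → + ind (suc zero) a ℤ.- + ind zero a ≡ + ind (suc zero) b ℤ.- + ind zero b → ind zero a ≡ ind zero b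
    compare zero          zero          _ = refl
    compare zero          (suc zero)    ()
    compare zero          (suc (suc b)) ()
    compare (suc zero)    zero          ()
    compare (suc zero)    (suc zero)    _ = refl
    compare (suc zero)    (suc (suc b)) ()
    compare (suc (suc a)) zero          ()
    compare (suc (suc a)) (suc zero)    ()
    compare (suc (suc a)) (suc (suc b)) _ = refl
    single : Proc leaf Any ⊤ SameZeros 1 Full
    single = step SameZeros (λ _ _ → plus (suc zero)) (λ _ _ _ _ _ → refl) (λ _ _ _ _ → tt)
      (λ { (lf a) (lf b) _ e → compare a b (e tt) }) (stop λ _ _ z → z)
    collect : ∀ D (x y : X (Pow D leaf)) → PowRel D SameZeros x y → SameZeros x y
    collect zero    x       y         m = m []
    collect (suc D) (l ∙ r) (l′ ∙ r′) m = collect D l l′ (m ∘ (true ∷_)) , collect D r r′ (m ∘ (false ∷_))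

  totals : ∀ A → Proc A Any Colour (λ x y → SameZeros x y × SameCounts x y) 1 SameZeros
  totals A = step _ (λ _ → monochrome A) (λ _ _ _ _ _ → refl) (λ _ _ _ _ → tt)
    (λ x y z e → z , λ c → monochrome⇒cnt x y c z (e c)) (stop λ _ _ m → m)

  -- 62 = 1 + 1 + 60: `zeros` asks `2 ^ D` queries, `totals` one per colour and hence at most
  -- `2 ^ D`, and the phases at most `60 * 2 ^ D`.
  block : ∀ D → suc (suc κ) ≤ 2 ^ D → Proc (Pow D leaf) Any ⊤ _≡_ (62 * 2 ^ D) Full
  block D k≤ = pad tt bound
      (flatten _ (W↔Fin D ×↔Fin one↔) (zeros D) ⨾ flatten _ ↔-refl (totals (Pow D leaf)) ⨾
       post (λ x y (_ , k) → Refined⇒≡ x y k) (pre start (proj₂ (proj₂ all))))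
    where
    all = phases (suc D) D ℕₚ.≤-refl
    L = proj₁ all
    L-le = proj₁ (proj₂ all)
    s = 2 ^ D
    size : leaves (Pow D leaf) ≡ s
    size = trans (leaves-Pow D leaf) (ℕₚ.*-identityʳ _)
    -- No colour occurs `2 ^ suc D` times among `2 ^ D` leaves, so the totals alone start the first
    -- phase.
    start : ∀ (x y : X (Pow D leaf)) → SameZeros x y × SameCounts x y → AllRefined (2 ^ suc D) x y
    start x y (z , e) = z , λ c → light⇒Refined x y (e c)
      (ℕₚ.≤-<-trans (ℕₚ.≤-trans (cnt≤leaves c x) (ℕₚ.≤-reflexive size)) (ℕₚ.^-monoʳ-< 2 (s≤s (s≤s z≤n)) (ℕₚ.n<1+n D)))
    L≤ : L ≤ 60 * s
    L≤ = ℕₚ.*-cancelʳ-≤ L (60 * s) (2 ^ suc D) {{ℕ.>-nonZero (ℕₚ.m^n>0 2 (suc D))}} (ℕₚ.≤-trans (ℕₚ.m≤m+n _ _) L-le)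
    bound : 1 * (s * 1) + (1 * suc (suc κ) + L) ≤ 62 * s
    bound = ℕₚ.≤-trans (ℕₚ.+-monoʳ-≤ (1 * (s * 1)) (ℕₚ.+-mono-≤ (ℕₚ.*-monoʳ-≤ 1 k≤) L≤))
      (ℕₚ.≤-reflexive (lemma 60 s))
      where
      lemma : ∀ c s → 1 * (s * 1) + (1 * s + c * s) ≡ suc (suc c) * s
      lemma = solveℕ-∀

-- Combining blocks, and playing plans as strategies

module Assembly (κ : ℕ) where
  open Counts κ
  open Block κ using (Full; block)

  PowRel-≡ : ∀ {A} d (x y : X (Pow d A)) → PowRel d _≡_ x y → x ≡ y
  PowRel-≡ zero    x       y         m = m []
  PowRel-≡ (suc d) (l ∙ r) (l′ ∙ r′) m =
    cong₂ _∙_ (PowRel-≡ d l l′ (m ∘ (true ∷_))) (PowRel-≡ d r r′ (m ∘ (false ∷_)))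

  ∣a-b∣≤1 : ∀ {a b} → a ≤ 1 → b ≤ 1 → ∣ + a ℤ.- + b ∣ ≤ 1
  ∣a-b∣≤1 p q = ℕₚ.≤-pred (∣a-b∣<c (s≤s p) (s≤s q))

  ans-bound : ∀ {A} (x : X A) q → ∣ ans x q ∣ ≤ leaves A
  ans-bound (lf a)  blank     = z≤n
  ans-bound (lf a)  (plus c)  = ∣a-b∣≤1 (cnt≤leaves c (lf a)) (cnt≤leaves zero (lf a))
  ans-bound (lf a)  (minus c) = ∣a-b∣≤1 (cnt≤leaves zero (lf a)) (cnt≤leaves c (lf a))
  ans-bound (l ∙ r) (p ∙ q)   = ℕₚ.≤-trans (ℤₚ.∣i+j∣≤∣i∣+∣j∣ (ans l p) (ans r q)) (ℕₚ.+-mono-≤ (ans-bound l p) (ans-bound r q))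

  small-diff : ∀ {A} r → leaves A + leaves A < 2 ^ r → ∀ (x y : X A) q → Small r (ans x q ℤ.- ans y q)
  small-diff r lt x y q = ℕₚ.≤-<-trans
    (ℕₚ.≤-trans (ℤₚ.∣i-j∣≤∣i∣+∣j∣ (ans x q) (ans y q)) (ℕₚ.+-mono-≤ (ans-bound x q) (ans-bound y q))) lt

  module Stack (r L : ℕ) (B : Shape) (small : leaves B + leaves B < 2 ^ r) (P : Proc B Any ⊤ _≡_ L Full) where

    p : ℕ
    p = 2 ^ (r + r)

    -- Z i contains (i + 1) * p ^ i copies of B but needs only 2 * p ^ i queries per round.
    Y Z : ℕ → Shape
    Y zero    = B
    Y (suc i) = Pow (r + r) (Y i)
    Z zero    = B
    Z (suc i) = Pow (r + r) (Z i) ⊗ Pow (r + r) (Y i)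

    J : ℕ → Set
    J zero    = ⊤
    J (suc i) = W (r + r) × J i

    J↔Fin : ∀ i → J i ↔ Fin (p ^ i)
    J↔Fin zero    = one↔
    J↔Fin (suc i) = W↔Fin (r + r) ×↔Fin J↔Fin i

    -- Answers on `B` are at most `leaves B` in absolute value, so by `small` a complete plan for
    -- `B` can serve as items unchanged.
    items : ∀ i → Proc (Y i) (Small r) (J i) _≡_ L Full
    items zero    = okMap (small-diff r small) P
    items (suc i) = post (PowRel-≡ (r + r)) (pre (λ _ _ _ _ → tt) (parallel (r + r) (items i)))

    solveZ : ∀ i → Proc (Z i) Any (Bool × J i) _≡_ L Full
    solveZ zero    = reindex tt (fits one↔ (↔-sym Finₚ.2↔Bool ×↔Fin one↔) (s≤s z≤n)) P
    solveZ (suc i) =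
      post (λ { (l ∙ u) (l′ ∙ u′) (m , n) → cong₂ _∙_ (PowRel-≡ (r + r) l l′ m) (PowRel-≡ (r + r) u u′ n) })
        (pre (λ { (l ∙ u) (l′ ∙ u′) _ → (λ _ → tt) , λ _ → tt })
          (merge r (solveZ i) (parallel (r + r) (items i))))

    rowsZ : ∀ i → Proc (Z i) Any ⊤ _≡_ (L * (2 * p ^ i)) Full
    rowsZ i = flatten _ (↔-sym Finₚ.2↔Bool ×↔Fin J↔Fin i) (solveZ i)

    leaves-Y : ∀ i → leaves (Y i) ≡ p ^ i * leaves B
    leaves-Y zero    = sym (ℕₚ.+-identityʳ _)
    leaves-Y (suc i) = trans (leaves-Pow (r + r) (Y i)) (trans (cong (p *_) (leaves-Y i)) (sym (ℕₚ.*-assoc p (p ^ i) (leaves B))))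

    leaves-Z : ∀ i → leaves (Z i) ≡ suc i * (p ^ i * leaves B)
    leaves-Z zero    = lemma (leaves B)
      where
      lemma : ∀ b → b ≡ 1 * (1 * b)
      lemma = solveℕ-∀
    leaves-Z (suc i) = trans (cong₂ _+_ (trans (leaves-Pow (r + r) (Z i)) (cong (p *_) (leaves-Z i)))
                                         (trans (leaves-Pow (r + r) (Y i)) (cong (p *_) (leaves-Y i))))
                           (lemma i p (p ^ i) (leaves B))
      where
      lemma : ∀ i p q b → p * (suc i * (q * b)) + p * (q * b) ≡ suc (suc i) * ((p * q) * b)
      lemma = solveℕ-∀

  copies : ℕ → Shape → Shape
  copies zero    A = A
  copies (suc q) A = A ⊗ copies q A

  leaves-copies : ∀ q A → leaves (copies q A) ≡ suc q * leaves A
  leaves-copies zero    A = sym (ℕₚ.+-identityʳ _)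
  leaves-copies (suc q) A = cong (λ s → leaves A + s) (leaves-copies q A)

  solve-copies : ∀ {A t} q → Proc A Any ⊤ _≡_ t Full → Proc (copies q A) Any ⊤ _≡_ (suc q * t) Full
  solve-copies {A} {t} zero    P = subst (λ s → Proc A Any ⊤ _≡_ s Full) (sym (ℕₚ.+-identityʳ t)) P
  solve-copies {A} {t} (suc q) P =
    pre (λ { (l ∙ u) (l′ ∙ u′) _ → tt , tt }) (left Full P) ⨾
    post (λ { (l ∙ u) (l′ ∙ u′) (m , n) → cong₂ _∙_ m n }) (swapped (left _≡_ (solve-copies q P)) )

  -- A signed query is asked as two real ones which use colour zero wherever it is blank;
  -- positions outside the game are coloured zero and contribute a known amount.
  record Sim (n : ℕ) (A : Shape) : Set where
    field
      embed : Code n (suc (suc κ)) → X A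
      embed-injective : ∀ x y → embed x ≡ embed y → x ≡ y
      asked⁺ asked⁻ : Q A → Code n (suc (suc κ))
      padding : Q A → ℤ
      ans-embed : ∀ x q → ans (embed x) q ≡ (+ bp x (asked⁺ q) ℤ.- + bp x (asked⁻ q)) ℤ.+ padding q

  bp-++ : ∀ {k m n} (x p : Code m k) (y q : Code n k) → bp (x ++ y) (p ++ q) ≡ bp x p + bp y q
  bp-++ []      []      y q = refl
  bp-++ (a ∷ x) (b ∷ p) y q with a Finₚ.≟ b
  ... | yes _ = cong suc (bp-++ x p y q)
  ... | no  _ = bp-++ x p y q

  bp-single : ∀ a c → bp (a ∷ []) (c ∷ []) ≡ ind c a
  bp-single a c with a Finₚ.≟ c
  ... | yes _ = refl
  ... | no  _ = refl

  sim-leaf : Sim 1 leaf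
  sim-leaf = record
    { embed = λ { (a ∷ []) → lf a }
    ; embed-injective = λ { (a ∷ []) (b ∷ []) refl → refl }
    ; asked⁺ = λ { blank → zero ∷ [] ; (plus c) → c ∷ [] ; (minus c) → zero ∷ [] }
    ; asked⁻ = λ { blank → zero ∷ [] ; (plus c) → zero ∷ [] ; (minus c) → c ∷ [] }
    ; padding = λ _ → 0ℤ
    ; ans-embed = λ
      { (a ∷ []) blank     → trans (sym (ℤₚ.+-inverseʳ (+ bp (a ∷ []) (zero ∷ [])))) (sym (ℤₚ.+-identityʳ _))
      ; (a ∷ []) (plus c)  → trans (sym (cong₂ (λ m n → + m ℤ.- + n) (bp-single a c) (bp-single a zero))) (sym (ℤₚ.+-identityʳ _))
      ; (a ∷ []) (minus c) → trans (sym (cong₂ (λ m n → + m ℤ.- + n) (bp-single a zero) (bp-single a c))) (sym (ℤₚ.+-identityʳ _)) }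
    }

  allZero : ∀ A → X A
  allZero leaf    = lf zero
  allZero (A ⊗ B) = allZero A ∙ allZero B

  sim-empty : ∀ A → Sim 0 A
  sim-empty A = record
    { embed = λ _ → allZero A
    ; embed-injective = λ { [] [] _ → refl }
    ; asked⁺ = λ _ → [] ; asked⁻ = λ _ → []
    ; padding = ans (allZero A)
    ; ans-embed = λ { [] q → sym (ℤₚ.+-identityˡ _) }
    }

  sim-⊗ : ∀ {m n A B} → Sim m A → Sim n B → Sim (m + n) (A ⊗ B)
  sim-⊗ {m} {n} {A} {B} S T = record
    { embed = embed′
    ; embed-injective = inj
    ; asked⁺ = λ { (p ∙ q) → S.asked⁺ p ++ T.asked⁺ q } ; asked⁻ = λ { (p ∙ q) → S.asked⁻ p ++ T.asked⁻ q }
    ; padding = λ { (p ∙ q) → S.padding p ℤ.+ T.padding q }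
    ; ans-embed = λ { x (p ∙ q) → eq x p q }
    }
    where
    module S = Sim S
    module T = Sim T
    embed′ : Code (m + n) (suc (suc κ)) → X (A ⊗ B)
    embed′ x = S.embed (Vec.take m x) ∙ T.embed (Vec.drop m x)
    ∙-injective : ∀ {x x′ : X A} {y y′ : X B} → _≡_ {A = X (A ⊗ B)} (x ∙ y) (x′ ∙ y′) → x ≡ x′ × y ≡ y′
    ∙-injective refl = refl , refl
    inj : ∀ x y → embed′ x ≡ embed′ y → x ≡ y
    inj x y e = let (e₁ , e₂) = ∙-injective e in begin
      x                            ≡⟨ Vecₚ.take++drop≡id m x ⟨
      Vec.take m x ++ Vec.drop m x ≡⟨ cong₂ _++_ (S.embed-injective _ _ e₁) (T.embed-injective _ _ e₂) ⟩
      Vec.take m y ++ Vec.drop m y ≡⟨ Vecₚ.take++drop≡id m y ⟩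
      y                            ∎
      where open ≡-Reasoning
    halves : ∀ x (p : Code m _) (q : Code n _) → bp x (p ++ q) ≡ bp (Vec.take m x) p + bp (Vec.drop m x) q
    halves x p q = trans (cong (λ x → bp x (p ++ q)) (sym (Vecₚ.take++drop≡id m x))) (bp-++ (Vec.take m x) p _ q)
    eq : ∀ x p q → ans (S.embed (Vec.take m x)) p ℤ.+ ans (T.embed (Vec.drop m x)) q ≡
         (+ bp x (S.asked⁺ p ++ T.asked⁺ q) ℤ.- + bp x (S.asked⁻ p ++ T.asked⁻ q)) ℤ.+ (S.padding p ℤ.+ T.padding q)
    eq x p q rewrite halves x (S.asked⁺ p) (T.asked⁺ q) | halves x (S.asked⁻ p) (T.asked⁻ q)
      | S.ans-embed (Vec.take m x) p | T.ans-embed (Vec.drop m x) q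
      | ℤₚ.pos-+ (bp (Vec.take m x) (S.asked⁺ p)) (bp (Vec.drop m x) (T.asked⁺ q))
      | ℤₚ.pos-+ (bp (Vec.take m x) (S.asked⁻ p)) (bp (Vec.drop m x) (T.asked⁻ q))
      = lemma (+ bp (Vec.take m x) (S.asked⁺ p)) (+ bp (Vec.drop m x) (T.asked⁺ q))
              (+ bp (Vec.take m x) (S.asked⁻ p)) (+ bp (Vec.drop m x) (T.asked⁻ q)) (S.padding p) (T.padding q)
      where
      lemma : ∀ a b c d e f → ((a ℤ.- c) ℤ.+ e) ℤ.+ ((b ℤ.- d) ℤ.+ f) ≡ ((a ℤ.+ b) ℤ.- (c ℤ.+ d)) ℤ.+ (e ℤ.+ f)
      lemma = solve-∀

  -- The positions of the game fill the tree from the left; the remaining leaves lie outside it.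
  sim : ∀ {n} A → n ≤ leaves A → Sim n A
  sim {zero}        leaf    _ = sim-empty leaf
  sim {suc zero}    leaf    _ = sim-leaf
  sim {suc (suc n)} leaf    (s≤s ())
  sim {n}           (A ⊗ B) n≤ = subst (λ m → Sim m (A ⊗ B)) (ℕₚ.m⊓n+n∸m≡n (leaves A) n)
    (sim-⊗ (sim A (ℕₚ.m⊓n≤m (leaves A) n)) (sim B (ℕₚ.m≤n+o⇒m∸n≤o n (leaves A) n≤)))

  codes : ∀ n → List (Code n (suc (suc κ)))
  codes zero    = [] ∷ []
  codes (suc n) = cartesianProductWith _∷_ (allFin _) (codes n)

  ∈-codes : ∀ {n} (x : Code n (suc (suc κ))) → x ∈ codes n
  ∈-codes []      = here refl
  ∈-codes (a ∷ x) = ∈-cartesianProductWith⁺ _∷_ (∈-allFin a) (∈-codes x)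

  module Play {n A} (S : Sim n A) where
    open Sim S

    guess : List (Code n (suc (suc κ))) → Code n (suc (suc κ))
    -- A default only: the hidden code itself always stays consistent with its answers.
    guess []       = Vec.replicate n zero
    guess (x ∷ xs) = x

    agree : Q A → ℕ → ℕ → List (Code n (suc (suc κ))) → List (Code n (suc (suc κ)))
    agree q a b = filter (λ y → (bp y (asked⁺ q) ℕ.≟ a) ×-dec (bp y (asked⁻ q) ℕ.≟ b))

    -- The query is computed from any code consistent with the answers so far: since that code has not
    -- been told apart from the hidden one, it yields an equivalent query.
    strategy : ∀ {t Ok K K′} → Proc A Ok ⊤ K′ t K → List (Code n (suc (suc κ))) → Strategy n (suc (suc κ)) (t * 2)
    strategy (stop _)           cs = tt
    strategy (step _ f _ _ _ P) cs = asked⁺ q , λ a → asked⁻ q , λ b → strategy P (agree q a b cs)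
      where q = f (embed (guess cs)) tt

    guess-∈ : ∀ {x} cs → x ∈ cs → guess cs ∈ cs
    guess-∈ (c ∷ cs) _ = here refl

    solves : ∀ {t Ok K} (P : Proc A Ok ⊤ _≡_ t K) cs x y → x ∈ cs →
             (∀ z → z ∈ cs → K (embed z) (embed x)) → K (embed y) (embed x) →
             responses (strategy P cs) x y ≡ responses (strategy P cs) x x → y ≡ x
    solves (stop g) cs x y x∈ known k _ = embed-injective y x (g _ _ k)
    solves {K = K} (step M f r o m P) cs x y x∈ known k e =
      solves P (agree q (bp x (asked⁺ q)) (bp x (asked⁻ q)) cs) x y
        (∈-filter⁺ _ x∈ (refl , refl))
        (λ z z∈ → let (z∈cs , (e⁺ , e⁻)) = ∈-filter⁻ _ {xs = cs} z∈ in next z (known z z∈cs) e⁺ e⁻)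
        (next y k (Vecₚ.∷-injectiveˡ e) (Vecₚ.∷-injectiveˡ (Vecₚ.∷-injectiveʳ e)))
        (Vecₚ.∷-injectiveʳ (Vecₚ.∷-injectiveʳ e))
      where
      q = f (embed (guess cs)) tt
      next : ∀ z → K (embed z) (embed x) → bp z (asked⁺ q) ≡ bp x (asked⁺ q) → bp z (asked⁻ q) ≡ bp x (asked⁻ q) → M (embed z) (embed x)
      next z kz e⁺ e⁻ = m _ _ kz λ { tt → begin
        ans (embed z) (f (embed z) tt) ≡⟨ same z kz (embed z) ⟩
        ans (embed z) q                ≡⟨ trans (ans-embed z q) (trans (cong₂ (λ a b → (+ a ℤ.- + b) ℤ.+ padding q) e⁺ e⁻) (sym (ans-embed x q))) ⟩
        ans (embed x) q                ≡⟨ same z kz (embed x) ⟨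
        ans (embed x) (f (embed z) tt) ∎ }
        where
        open ≡-Reasoning
        same : ∀ z → K (embed z) (embed x) → ∀ w → ans w (f (embed z) tt) ≡ ans w q
        same z kz w = trans (r _ _ kz tt w) (sym (r _ _ (known (guess cs) (guess-∈ cs x∈)) tt w))

  solvable : ∀ {n A t} → n ≤ leaves A → Proc A Any ⊤ _≡_ t Full → SolvableIn n (suc (suc κ)) (t * 2)
  solvable {n} {A} n≤ P = Play.strategy S P (codes n) ,
    λ x y e → Play.solves S P (codes n) x y (∈-codes x) (λ _ _ → tt) tt e
    where S = sim A n≤

-- Lower bound

LogBounds : ℕ → Set
LogBounds n = 1 ≤ n → 2 ^ ⌊log₂ n ⌋ ≤ n × n < 2 ^ suc ⌊log₂ n ⌋

log-bounds : ∀ n → LogBounds n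
log-bounds = <-rec LogBounds go
  where
  ⌈n/2⌉≤1+⌊n/2⌋ : ∀ n → ℕ.⌈ n /2⌉ ≤ suc ℕ.⌊ n /2⌋
  ⌈n/2⌉≤1+⌊n/2⌋ zero          = z≤n
  ⌈n/2⌉≤1+⌊n/2⌋ (suc zero)    = s≤s z≤n
  ⌈n/2⌉≤1+⌊n/2⌋ (suc (suc n)) = s≤s (⌈n/2⌉≤1+⌊n/2⌋ n)
  double : ∀ h → 2 * h ≡ h + h
  double = solveℕ-∀
  go : ∀ n → (∀ {m} → m < n → LogBounds m) → LogBounds n
  go (suc zero)      _   _ = s≤s z≤n , s≤s (s≤s z≤n)
  go n@(suc (suc m)) rec _ = subst (λ e → 2 ^ e ≤ n × n < 2 ^ suc e) (sym log-n) (lower , upper)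
    where
    h = ℕ.⌊ n /2⌋
    log-n : ⌊log₂ n ⌋ ≡ suc ⌊log₂ h ⌋
    log-n = trans (sym (ℕₚ.suc-pred ⌊log₂ n ⌋ {{ℕ.>-nonZero (⌊log₂⌋-mono-≤ {2} {n} (s≤s (s≤s z≤n)))}}))
                  (cong suc (sym (⌊log₂⌊n/2⌋⌋≡⌊log₂n⌋∸1 n)))
    half : 2 ^ ⌊log₂ h ⌋ ≤ h × h < 2 ^ suc ⌊log₂ h ⌋
    half = rec (ℕₚ.⌊n/2⌋<n (suc m)) (s≤s z≤n)
    open ℕₚ.≤-Reasoning
    lower : 2 * 2 ^ ⌊log₂ h ⌋ ≤ n
    lower = begin
      2 * 2 ^ ⌊log₂ h ⌋ ≤⟨ ℕₚ.*-monoʳ-≤ 2 (proj₁ half) ⟩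
      2 * h             ≡⟨ double h ⟩
      h + h             ≤⟨ ℕₚ.+-monoʳ-≤ h (ℕₚ.⌊n/2⌋≤⌈n/2⌉ n) ⟩
      h + ℕ.⌈ n /2⌉     ≡⟨ ℕₚ.⌊n/2⌋+⌈n/2⌉≡n n ⟩
      n                 ∎
    upper : n < 2 * 2 ^ suc ⌊log₂ h ⌋
    upper = begin-strict
      n                     ≡⟨ ℕₚ.⌊n/2⌋+⌈n/2⌉≡n n ⟨
      h + ℕ.⌈ n /2⌉         ≤⟨ ℕₚ.+-monoʳ-≤ h (⌈n/2⌉≤1+⌊n/2⌋ n) ⟩
      h + suc h             <⟨ ℕₚ.n<1+n _ ⟩
      suc h + suc h         ≡⟨ double (suc h) ⟨
      2 * suc h             ≤⟨ ℕₚ.*-monoʳ-≤ 2 (proj₂ half) ⟩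
      2 * 2 ^ suc ⌊log₂ h ⌋ ∎

n<2^n : ∀ n → n < 2 ^ n
n<2^n zero    = s≤s z≤n
n<2^n (suc n) = ℕₚ.+-mono-≤ (ℕₚ.m^n>0 2 n) (ℕₚ.≤-trans (n<2^n n) (ℕₚ.m≤m+n _ 0))

2^-reflects-≤ : ∀ {a b} → 2 ^ a ≤ 2 ^ b → a ≤ b
2^-reflects-≤ {a} {b} p with a ≤? b
... | yes q = q
... | no ¬q = ⊥-elim (ℕₚ.<⇒≱ (ℕₚ.^-monoʳ-< 2 (s≤s (s≤s z≤n)) (ℕₚ.≰⇒> ¬q)) p)

vec↔Fin : ∀ m d → Vec (Fin m) d ↔ Fin (m ^ d)
vec↔Fin m zero    = mk↔ₛ′ (λ _ → zero) (λ _ → []) (λ { zero → refl }) (λ { [] → refl })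
vec↔Fin m (suc d) = ↔-trans cons (↔-refl {A = Fin m} ×↔Fin vec↔Fin m d)
  where
  cons : Vec (Fin m) (suc d) ↔ (Fin m × Vec (Fin m) d)
  cons = mk↔ₛ′ (λ { (a ∷ v) → a , v }) (λ { (a , v) → a ∷ v }) (λ _ → refl) (λ { (a ∷ v) → refl })

bp≤n : ∀ {n k} (x q : Code n k) → bp x q ≤ n
bp≤n []      []      = z≤n
bp≤n (a ∷ x) (b ∷ q) with a Finₚ.≟ b
... | yes _ = s≤s (bp≤n x q)
... | no  _ = ℕₚ.m≤n⇒m≤1+n (bp≤n x q)

transcript : ∀ {n k t} → Strategy n k t → Code n k → Vec (Fin (suc n)) t
transcript {t = zero}  S       x = []
transcript {t = suc t} (q , f) x = Fin.fromℕ< (s≤s (bp≤n x q)) ∷ transcript (f (bp x q)) x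

-- Equal answers lead along the same path, so codes compared on their own paths are in fact compared
-- on that of `x`.
transcript-responses : ∀ {n k t} (S : Strategy n k t) x y →
                       transcript S x ≡ transcript S y → responses S x y ≡ responses S x x
transcript-responses {t = zero}  S       x y _ = refl
transcript-responses {t = suc t} (q , f) x y e = cong₂ _∷_ (sym same)
  (transcript-responses (f (bp x q)) x y
    (trans (Vecₚ.∷-injectiveʳ e) (cong (λ a → transcript (f a) y) (sym same))))
  where
  same : bp x q ≡ bp y q
  same = trans (sym (Finₚ.toℕ-fromℕ< _)) (trans (cong Fin.toℕ (Vecₚ.∷-injectiveˡ e)) (Finₚ.toℕ-fromℕ< _))

information-bound : ∀ {n k t} → SolvableIn n k t → k ^ n ≤ suc n ^ t
information-bound {n} {k} {t} (S , solves) = Finₚ.injective⇒≤ {f = encode} λ {i} {j} e →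
    to-injective (↔-sym (vec↔Fin k n))
      (solves _ _ (transcript-responses S (from (vec↔Fin k n) j) (from (vec↔Fin k n) i) (sym (to-injective (vec↔Fin (suc n) t) e))))
  where
  open Inverse using (to; from; inverseʳ)
  encode : Fin (k ^ n) → Fin (suc n ^ t)
  encode i = to (vec↔Fin (suc n) t) (transcript S (from (vec↔Fin k n) i))
  to-injective : ∀ {A B : Set} (ι : A ↔ B) {x y} → to ι x ≡ to ι y → x ≡ y
  to-injective ι e = trans (sym (inverseʳ ι refl)) (inverseʳ ι e)

fresh : ∀ {k t} (f : Fin t → Fin k) → t < k → Σ (Fin k) λ c → ∀ i → c ≢ f i
fresh {k} {t} f t<k with Finₚ.any? (λ c → Finₚ.all? (λ i → ¬? (c Finₚ.≟ f i)))
... | yes p = p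
... | no ¬p = ⊥-elim (Finₚ.<⇒notInjective {f = proj₁ ∘ index} t<k λ {c} {d} e →
    trans (proj₂ (index c)) (trans (cong f e) (sym (proj₂ (index d)))))
  where
  index : ∀ c → Σ (Fin t) λ i → c ≡ f i
  index c with Finₚ.¬∀⟶∃¬ t (λ i → c ≢ f i) (λ i → ¬? (c Finₚ.≟ f i)) (λ all → ¬p (c , all))
  ... | i , ¬¬e = i , decidable-stable (c Finₚ.≟ f i) ¬¬e

bp-∷-≢ : ∀ {n k} (a b : Fin k) {x q : Code n k} → a ≢ b → bp (a ∷ x) (b ∷ q) ≡ bp x q
bp-∷-≢ a b a≢b with a Finₚ.≟ b
... | yes e = ⊥-elim (a≢b e)
... | no  _ = refl

avoid : ∀ {n k t} (Q : Fin t → Code n k) → t < k → Σ (Code n k) λ x → ∀ i → bp x (Q i) ≡ 0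
avoid {zero}  Q t<k = [] , λ i → empty (Q i)
  where
  empty : ∀ {k} (q : Code 0 k) → bp [] q ≡ 0
  empty [] = refl
avoid {suc n} Q t<k =
  let (a , a≢) = fresh (Vec.head ∘ Q) t<k
      (x , x0) = avoid (Vec.tail ∘ Q) t<k
  in a ∷ x , λ i → prepend (Q i) (a≢ i) (x0 i)
  where
  prepend : ∀ {n k a} {x : Code n k} (q : Code (suc n) k) → a ≢ Vec.head q → bp x (Vec.tail q) ≡ 0 → bp (a ∷ x) q ≡ 0
  prepend {a = a} (b ∷ q) a≢b e = trans (bp-∷-≢ a b a≢b) e

zeroPath : ∀ {n k t} → Strategy n k t → Fin t → Code n k
zeroPath {t = suc t} (q , f) zero    = q
zeroPath {t = suc t} (q , f) (suc i) = zeroPath (f 0) i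

zeroPath-responses : ∀ {n k t} (S : Strategy n k t) x y → (∀ i → bp x (zeroPath S i) ≡ 0) →
                     (∀ i → bp y (zeroPath S i) ≡ 0) → responses S x y ≡ responses S x x
zeroPath-responses {t = zero}  S       x y _  _  = refl
zeroPath-responses {t = suc t} (q , f) x y x0 y0 rewrite x0 zero | y0 zero =
  cong (0 ∷_) (zeroPath-responses (f 0) x y (x0 ∘ suc) (y0 ∘ suc))

-- Adversary argument: if all answers are zero and `k` is at least `t + 2`, two colours were never
-- asked at the first position, while the other positions can avoid all queries. Both resulting
-- codes remain possible.
colour-bound : ∀ {n k t} → 1 ≤ n → SolvableIn n k t → k ≤ suc t
colour-bound {suc n} {k} {t} _ (S , solves) with k ≤? suc t
... | yes p = p
... | no ¬p = ⊥-elim (b≢a (Vecₚ.∷-injectiveˡ (solves (a ∷ x) (b ∷ x)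
      (zeroPath-responses S (a ∷ x) (b ∷ x) (extend a a≢) (extend b b≢)))))
  where
  t+2≤k : suc t < k
  t+2≤k = ℕₚ.≰⇒> ¬p
  heads : Fin t → Fin k
  heads = Vec.head ∘ zeroPath S
  fresh-a = fresh heads (ℕₚ.<-trans (ℕₚ.n<1+n t) t+2≤k)
  a = proj₁ fresh-a
  a≢ : ∀ i → a ≢ heads i
  a≢ = proj₂ fresh-a
  and-a : Fin (suc t) → Fin k
  and-a zero    = a
  and-a (suc i) = heads i
  fresh-b = fresh and-a t+2≤k
  b = proj₁ fresh-b
  b≢a : b ≢ a
  b≢a = proj₂ fresh-b zero
  b≢ : ∀ i → b ≢ heads i
  b≢ i = proj₂ fresh-b (suc i)
  avoided = avoid (Vec.tail ∘ zeroPath S) (ℕₚ.<-trans (ℕₚ.n<1+n t) t+2≤k)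
  x = proj₁ avoided
  extend : ∀ c → (∀ i → c ≢ heads i) → ∀ i → bp (c ∷ x) (zeroPath S i) ≡ 0
  extend c c≢ i with zeroPath S i | c≢ i | proj₂ avoided i
  ... | h ∷ q | c≢h | e = trans (bp-∷-≢ c h c≢h) e

-- 4 = 2 + 2: `suc t` is at most `2 * t` because `k` is at least 2, and `suc ℓ` is at most `2 * ℓ`
-- because `n` is at least 2.
lower-bound : ∀ n k → 2 ≤ n → 2 ≤ k → ∀ t → SolvableIn n k t →
              n * ⌊log₂ k ⌋ + k * ⌊log₂ n ⌋ ≤ 4 * (t * ⌊log₂ n ⌋)
lower-bound n k 2≤n 2≤k t sol = begin
  n * c + k * ℓ             ≤⟨ ℕₚ.+-mono-≤ nc≤ (ℕₚ.*-monoˡ-≤ ℓ k≤2t) ⟩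
  2 * (t * ℓ) + (2 * t) * ℓ ≡⟨ lemma t ℓ ⟩
  4 * (t * ℓ)               ∎
  where
  open ℕₚ.≤-Reasoning
  ℓ = ⌊log₂ n ⌋
  c = ⌊log₂ k ⌋
  lemma : ∀ t ℓ → 2 * (t * ℓ) + (2 * t) * ℓ ≡ 4 * (t * ℓ)
  lemma = solveℕ-∀
  1≤n : 1 ≤ n
  1≤n = ℕₚ.≤-trans (s≤s z≤n) 2≤n
  k≤ : k ≤ suc t
  k≤ = colour-bound 1≤n sol
  1≤t : 1 ≤ t
  1≤t = ℕₚ.≤-pred (ℕₚ.≤-trans 2≤k k≤)
  k≤2t : k ≤ 2 * t
  k≤2t = ℕₚ.≤-trans k≤ (ℕₚ.+-mono-≤ 1≤t (ℕₚ.m≤m+n t 0))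
  1≤ℓ : 1 ≤ ℓ
  1≤ℓ = ⌊log₂⌋-mono-≤ 2≤n
  powers : 2 ^ (c * n) ≤ 2 ^ (suc ℓ * t)
  powers = begin
    2 ^ (c * n)     ≡⟨ ℕₚ.^-*-assoc 2 c n ⟨
    (2 ^ c) ^ n     ≤⟨ ℕₚ.^-monoˡ-≤ n (proj₁ (log-bounds k (ℕₚ.≤-trans (s≤s z≤n) 2≤k))) ⟩
    k ^ n           ≤⟨ information-bound sol ⟩
    suc n ^ t       ≤⟨ ℕₚ.^-monoˡ-≤ t (proj₂ (log-bounds n 1≤n)) ⟩
    (2 ^ suc ℓ) ^ t ≡⟨ ℕₚ.^-*-assoc 2 (suc ℓ) t ⟩
    2 ^ (suc ℓ * t) ∎
  nc≤ : n * c ≤ 2 * (t * ℓ)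
  nc≤ = begin
    n * c       ≡⟨ ℕₚ.*-comm n c ⟩
    c * n       ≤⟨ 2^-reflects-≤ powers ⟩
    suc ℓ * t   ≤⟨ ℕₚ.*-monoˡ-≤ t (ℕₚ.+-mono-≤ 1≤ℓ (ℕₚ.m≤m+n ℓ 0)) ⟩
    (2 * ℓ) * t ≡⟨ lemma′ ℓ t ⟩
    2 * (t * ℓ) ∎
    where
    lemma′ : ∀ ℓ t → (2 * ℓ) * t ≡ 2 * (t * ℓ)
    lemma′ = solveℕ-∀

-- Upper bound

-- The difference `d` is at least half of `m`, so the factor `m` costs no more than `2 * 2 ^ d`.
exponential-beats-linear : ∀ e m → e + e ≤ m → 2 ^ e * m ≤ 2 * 2 ^ m
exponential-beats-linear e m 2e≤m = begin
  2 ^ e * m           ≤⟨ ℕₚ.*-monoʳ-≤ (2 ^ e) m≤ ⟩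
  2 ^ e * (2 * d)     ≤⟨ ℕₚ.*-monoʳ-≤ (2 ^ e) (ℕₚ.*-monoʳ-≤ 2 (ℕₚ.<⇒≤ (n<2^n d))) ⟩
  2 ^ e * (2 * 2 ^ d) ≡⟨ lemma (2 ^ e) (2 ^ d) ⟩
  2 * (2 ^ e * 2 ^ d) ≡⟨ cong (2 *_) (ℕₚ.^-distribˡ-+-* 2 e d) ⟨
  2 * 2 ^ (e + d)     ≡⟨ cong (λ z → 2 * 2 ^ z) (ℕₚ.m+[n∸m]≡n e≤m) ⟩
  2 * 2 ^ m           ∎
  where
  open ℕₚ.≤-Reasoning
  d = m ∸ e
  e≤m : e ≤ m
  e≤m = ℕₚ.≤-trans (ℕₚ.m≤m+n e e) 2e≤m
  lemma : ∀ a b → a * (2 * b) ≡ 2 * (a * b)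
  lemma = solveℕ-∀
  double : ∀ d → d + d ≡ 2 * d
  double = solveℕ-∀
  m≤ : m ≤ 2 * d
  m≤ = begin
    m     ≡⟨ ℕₚ.m+[n∸m]≡n e≤m ⟨
    e + d ≤⟨ ℕₚ.+-monoˡ-≤ d (ℕₚ.m+n≤o⇒m≤o∸n e 2e≤m) ⟩
    d + d ≡⟨ double d ⟩
    2 * d ∎

-- There are `q` full stacks and a last one. The 4 combines the two rows per item slot in `rowsZ`
-- with the two real queries per signed one; 26 = 24 + 2 comes from `full-stacks` and `last-stack`.
total-bound : ∀ a q s P ℓ x y → q * (P * s) * ℓ ≤ 24 * x → (P * s) * ℓ ≤ 2 * x + 2 * y →
              (suc q * (a * s * (2 * P))) * 2 * ℓ ≤ (a * 4 * 26) * (x + y)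
total-bound a q s P ℓ x y full last = begin
  (suc q * (a * s * (2 * P))) * 2 * ℓ         ≡⟨ lemma a q s P ℓ ⟩
  a * 4 * (q * (P * s) * ℓ + (P * s) * ℓ)     ≤⟨ ℕₚ.*-monoʳ-≤ (a * 4) (ℕₚ.+-mono-≤ full last) ⟩
  a * 4 * (24 * x + (2 * x + 2 * y))          ≤⟨ ℕₚ.*-monoʳ-≤ (a * 4) (ℕₚ.m≤m+n _ (24 * y)) ⟩
  a * 4 * (24 * x + (2 * x + 2 * y) + 24 * y) ≡⟨ cong (a * 4 *_) (lemma′ 24 x y) ⟩
  a * 4 * (26 * (x + y))                      ≡⟨ ℕₚ.*-assoc (a * 4) 26 (x + y) ⟨
  (a * 4 * 26) * (x + y)                      ∎
  where
  open ℕₚ.≤-Reasoning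
  lemma : ∀ a q s P ℓ → (suc q * (a * s * (2 * P))) * 2 * ℓ ≡
          a * 4 * (q * (P * s) * ℓ + (P * s) * ℓ)
  lemma = solveℕ-∀
  lemma′ : ∀ c a b → (c * a + (2 * a + 2 * b)) + c * b ≡ suc (suc c) * (a + b)
  lemma′ = solveℕ-∀

module Upper (n κ : ℕ) (2≤n : 2 ≤ n) where
  -- The choice of i keeps p ^ i * 2 ^ D below 2 ^ (ℓ / 2) ≤ √n unless i = 0.
  k c ℓ D r i : ℕ
  k = suc (suc κ)
  c = ⌊log₂ k ⌋
  ℓ = ⌊log₂ n ⌋
  D = suc c
  r = suc (suc D)
  i = ℓ DivMod./ (6 * r)

  B : Shape
  B = Pow D leaf

  leaves-B : leaves B ≡ 2 ^ D
  leaves-B = trans (leaves-Pow D leaf) (ℕₚ.*-identityʳ _)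

  1≤c : 1 ≤ c
  1≤c = ⌊log₂⌋-mono-≤ {2} {k} (s≤s (s≤s z≤n))

  small : leaves B + leaves B < 2 ^ r
  small = begin-strict
    leaves B + leaves B ≡⟨ cong₂ _+_ leaves-B leaves-B ⟩
    2 ^ D + 2 ^ D       ≡⟨ lemma (2 ^ D) ⟩
    2 ^ suc D           <⟨ ℕₚ.^-monoʳ-< 2 (s≤s (s≤s z≤n)) (ℕₚ.n<1+n (suc D)) ⟩
    2 ^ r               ∎
    where
    open ℕₚ.≤-Reasoning
    lemma : ∀ a → a + a ≡ 2 * a
    lemma = solveℕ-∀

  open Counts κ
  open Block κ
  open Assembly κ
  open Stack r (62 * 2 ^ D) B small (block D (ℕₚ.<⇒≤ (proj₂ (log-bounds k (s≤s z≤n)))))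

  u M : ℕ
  u = p ^ i * 2 ^ D
  M = suc i * u

  instance
    M≢0 : ℕ.NonZero M
    M≢0 = ℕ.>-nonZero (ℕₚ.*-mono-≤ {1} {suc i} {1} {u} (s≤s z≤n)
      (ℕₚ.*-mono-≤ {1} {p ^ i} {1} (ℕₚ.m^n>0 p {{ℕ.>-nonZero (ℕₚ.m^n>0 2 (r + r))}} i) (ℕₚ.m^n>0 2 D)))

  q queries : ℕ
  q = n DivMod./ M
  queries = (suc q * (62 * 2 ^ D * (2 * p ^ i))) * 2

  enough : n ≤ leaves (copies q (Z i))
  enough = begin
    n                       ≡⟨ DivMod.m≡m%n+[m/n]*n n M ⟩
    n DivMod.% M + q * M    ≤⟨ ℕₚ.+-monoˡ-≤ (q * M) (ℕₚ.<⇒≤ (DivMod.m%n<n n M)) ⟩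
    suc q * M               ≡⟨ cong (suc q *_) (trans (leaves-Z i) (cong (λ b → suc i * (p ^ i * b)) leaves-B)) ⟨
    suc q * leaves (Z i)    ≡⟨ leaves-copies q (Z i) ⟨
    leaves (copies q (Z i)) ∎
    where open ℕₚ.≤-Reasoning

  winning : SolvableIn n k queries
  winning = solvable enough (solve-copies q (rowsZ i))

  r≤4c : r ≤ 4 * c
  r≤4c = begin
    3 + c     ≤⟨ ℕₚ.+-monoˡ-≤ c (ℕₚ.*-monoʳ-≤ 3 1≤c) ⟩
    3 * c + c ≡⟨ lemma c ⟩
    4 * c     ∎
    where
    open ℕₚ.≤-Reasoning
    lemma : ∀ c → 3 * c + c ≡ 4 * c
    lemma = solveℕ-∀

  ℓ≤ : ℓ ≤ suc i * (6 * r)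
  ℓ≤ = ℕₚ.≤-trans (ℕₚ.≤-reflexive (DivMod.m≡m%n+[m/n]*n ℓ (6 * r)))
    (ℕₚ.+-monoˡ-≤ (i * (6 * r)) (ℕₚ.<⇒≤ (DivMod.m%n<n ℓ (6 * r))))

  -- A stack has `suc i * u` positions, so `q` of them fit into `n`. By the choice of `i`, `suc i`
  -- is at least `ℓ / (6 * r)`, and `r` is at most `4 * c`; hence 24.
  full-stacks : q * u * ℓ ≤ 24 * (n * c)
  full-stacks = begin
    q * u * ℓ                 ≤⟨ ℕₚ.*-monoʳ-≤ (q * u) ℓ≤ ⟩
    q * u * (suc i * (6 * r)) ≡⟨ lemma q u (suc i) r ⟩
    6 * r * (q * (suc i * u)) ≤⟨ ℕₚ.*-mono-≤ (ℕₚ.*-monoʳ-≤ 6 r≤4c) (DivMod.m/n*n≤m n M) ⟩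
    6 * (4 * c) * n           ≡⟨ lemma′ 6 4 c n ⟩
    24 * (n * c)              ∎
    where
    open ℕₚ.≤-Reasoning
    lemma : ∀ q u j r → q * u * (j * (6 * r)) ≡ 6 * r * (q * (j * u))
    lemma = solveℕ-∀
    lemma′ : ∀ a b c n → a * (b * c) * n ≡ a * b * (n * c)
    lemma′ = solveℕ-∀

  -- If `i` is 0, then `u = 2 ^ D` is at most `2 * k` and is charged to the colours. Otherwise `u`
  -- is at most `2 ^ (3 * r * i)` with `6 * r * i ≤ ℓ`, so about `√n`, and even `u * ℓ` is at most
  -- `2 * n`. The argument `j` permits matching on `i`.
  last-stack : ∀ j → j ≡ i → u * ℓ ≤ 2 * (n * c) + 2 * (k * ℓ)
  last-stack zero    e = begin
    p ^ i * 2 ^ D * ℓ         ≡⟨ cong (λ j → p ^ j * 2 ^ D * ℓ) (sym e) ⟩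
    1 * (2 * 2 ^ c) * ℓ       ≤⟨ ℕₚ.*-monoˡ-≤ ℓ (ℕₚ.*-monoʳ-≤ 1 (ℕₚ.*-monoʳ-≤ 2 (proj₁ (log-bounds k (s≤s z≤n))))) ⟩
    1 * (2 * k) * ℓ           ≡⟨ lemma k ℓ ⟩
    2 * (k * ℓ)               ≤⟨ ℕₚ.m≤n+m _ (2 * (n * c)) ⟩
    2 * (n * c) + 2 * (k * ℓ) ∎
    where
    open ℕₚ.≤-Reasoning
    lemma : ∀ k ℓ → 1 * (2 * k) * ℓ ≡ 2 * (k * ℓ)
    lemma = solveℕ-∀
  last-stack (suc j) e = begin
    p ^ i * 2 ^ D * ℓ             ≡⟨ cong (λ z → z * 2 ^ D * ℓ) (ℕₚ.^-*-assoc 2 (r + r) i) ⟩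
    2 ^ ((r + r) * i) * 2 ^ D * ℓ ≡⟨ cong (_* ℓ) (ℕₚ.^-distribˡ-+-* 2 ((r + r) * i) D) ⟨
    2 ^ ((r + r) * i + D) * ℓ     ≤⟨ ℕₚ.*-monoˡ-≤ ℓ (ℕₚ.^-monoʳ-≤ 2 (ℕₚ.+-monoʳ-≤ ((r + r) * i) D≤)) ⟩
    2 ^ ((r + r) * i + r * i) * ℓ ≤⟨ exponential-beats-linear ((r + r) * i + r * i) ℓ exponent ⟩
    2 * 2 ^ ℓ                     ≤⟨ ℕₚ.*-monoʳ-≤ 2 (proj₁ (log-bounds n (ℕₚ.≤-trans (s≤s z≤n) 2≤n))) ⟩
    2 * n                         ≤⟨ ℕₚ.*-monoʳ-≤ 2 (ℕₚ.m≤m*n n c {{ℕ.>-nonZero 1≤c}}) ⟩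
    2 * (n * c)                   ≤⟨ ℕₚ.m≤m+n _ _ ⟩
    2 * (n * c) + 2 * (k * ℓ)     ∎
    where
    open ℕₚ.≤-Reasoning
    D≤ : D ≤ r * i
    D≤ = ℕₚ.≤-trans (ℕₚ.≤-trans (ℕₚ.n≤1+n D) (ℕₚ.n≤1+n (suc D)))
           (subst (λ i → r ≤ r * i) e (ℕₚ.m≤m*n r (suc j)))
    lemma : ∀ r i → ((r + r) * i + r * i) + ((r + r) * i + r * i) ≡ i * (6 * r)
    lemma = solveℕ-∀
    exponent : ((r + r) * i + r * i) + ((r + r) * i + r * i) ≤ ℓ
    exponent = ℕₚ.≤-trans (ℕₚ.≤-reflexive (lemma r i)) (DivMod.m/n*n≤m ℓ (6 * r))

  queries-bound : queries * ℓ ≤ (62 * 4 * 26) * (n * c + k * ℓ)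
  queries-bound = total-bound 62 q (2 ^ D) (p ^ i) ℓ (n * c) (k * ℓ) full-stacks (last-stack i refl)

upper-bound : ∀ n k → 2 ≤ n → 2 ≤ k → Σ ℕ λ t → SolvableIn n k t ×
              t * ⌊log₂ n ⌋ ≤ (62 * 4 * 26) * (n * ⌊log₂ k ⌋ + k * ⌊log₂ n ⌋)
upper-bound n (suc zero)    2≤n (s≤s ())
upper-bound n (suc (suc κ)) 2≤n 2≤k = queries , winning , queries-bound
  where open Upper n κ 2≤n

-- Both bounds are multiplied through by `⌊log₂ n ⌋`. For arguments from 2 on, the rounded logarithm
-- is at least half of the real one, so rounding affects only the constants.
theorem1 : Σ ℕ λ a → Σ ℕ λ C → ∀ (n k : ℕ) → 2 ≤ n → 2 ≤ k →
    ((∀ (t : ℕ) → SolvableIn n k t →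
    n * ⌊log₂ k ⌋ + k * ⌊log₂ n ⌋ ≤ a * (t * ⌊log₂ n ⌋))
    × Σ ℕ (λ t → SolvableIn n k t
    × t * ⌊log₂ n ⌋ ≤ C * (n * ⌊log₂ k ⌋ + k * ⌊log₂ n ⌋)))
theorem1 = 4 , 62 * 4 * 26 , λ n k 2≤n 2≤k → lower-bound n k 2≤n 2≤k , upper-bound n k 2≤n 2≤k
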